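{- For any $A\subseteq\mathbb{N}$ there exists an irreflexive interpolable relation $\prec^\ast_A$ on $\mathbb{N}$ such that for any $X\subseteq\mathbb{N}$: $A\leq_T X''$ if and only if there exists a relation on $\mathbb{N}$ that is c.e. relative to $X$ and isomorphic to $\prec^\ast_A$.
   Context: A relation is irreflexive if $x\prec x$ never holds; a transitive relation $\prec$ on $\mathbb{N}$ is interpolable if every initial segment $\{x\mid x\prec y\}$ is directed (non-empty and any two of its elements have a $\prec$-upper bound in it). $X''$ is the double Turing jump of $X$. -}

module Defs where

open import Data.Nat using (ℕ; zero; suc; _+_; _<_)
open import Data.Nat.Properties using (+-comm; +-suc; +-identityʳ)
open import Data.Product using (∃; ∃-syntax; _×_; _,_; proj₁; proj₂)
open import Data.Sum using (_⊎_)
open import Function.Bundles using (_⇔_)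
open import Level using (0ℓ)
open import Relation.Binary.Core using (Rel)
open import Relation.Binary.Definitions using (Transitive)
open import Relation.Binary.Morphism.Structures using (IsOrderIsomorphism)
open import Relation.Binary.PropositionalEquality
  using (_≡_; refl; trans; sym)
open import Relation.Nullary using (¬_)
open import Relation.Unary using (Pred)

-- Cantor's bijection ℕ × ℕ → ℕ.  `unpair` walks along the antidiagonals.

triangle : ℕ → ℕ
triangle zero    = zero
triangle (suc n) = suc n + triangle n

⟨_,_⟩ : ℕ → ℕ → ℕ
⟨ m , n ⟩ = triangle (m + n) + n

next : ℕ × ℕ → ℕ × ℕ
next (zero  , n) = suc n , zero
next (suc m , n) = m , suc n

unpair : ℕ → ℕ × ℕ
unpair zero    = zero , zero
unpair (suc k) = next (unpair k)

π₁ π₂ : ℕ → ℕ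
π₁ k = proj₁ (unpair k)
π₂ k = proj₂ (unpair k)

unpair-⟨,⟩ : ∀ m n → unpair ⟨ m , n ⟩ ≡ (m , n)
unpair-⟨,⟩ m n = diagonal (m + n) n m refl
  where
  diagonal : ∀ s n m → m + n ≡ s → unpair (triangle s + n) ≡ (m , n)
  diagonal s (suc n) m eq
    rewrite +-suc (triangle s) n
          | diagonal s n (suc m) (trans (sym (+-suc m n)) eq) = refl
  diagonal s zero m eq
    rewrite +-identityʳ m | +-identityʳ (triangle s) = edge s m eq
    where
    edge : ∀ s m → m ≡ s → unpair (triangle s) ≡ (m , zero)
    edge zero    .zero    refl = refl
    edge (suc s) .(suc s) refl
      rewrite +-comm s (triangle s) | diagonal s s zero refl = refl

-- Kleene's partial recursive functions relative to an oracle.  Every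
-- program is unary; several arguments are passed as a Cantor pair.

data Code : Set where
  zeroᶜ succᶜ leftᶜ rightᶜ oracleᶜ : Code
  pairᶜ compᶜ precᶜ : Code → Code → Code
  muᶜ : Code → Code

-- Graph of n ↦ r(a,n), where r(a,0) = g(a) and
-- r(a,n+1) = h⟨a,⟨n,r(a,n)⟩⟩, for g, h given by their graphs G, H.

PrimRec : Rel ℕ 0ℓ → Rel ℕ 0ℓ → ℕ → Rel ℕ 0ℓ
PrimRec G H a zero    y = G a y
PrimRec G H a (suc n) y =
  ∃[ r ] PrimRec G H a n r × H ⟨ a , ⟨ n , r ⟩ ⟩ y

-- Eval O e x y: program e with oracle O halts on input x with output y.

Eval : Pred ℕ 0ℓ → Code → Rel ℕ 0ℓ
Eval O zeroᶜ       x y = y ≡ 0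
Eval O succᶜ       x y = y ≡ suc x
Eval O leftᶜ       x y = y ≡ π₁ x
Eval O rightᶜ      x y = y ≡ π₂ x
Eval O oracleᶜ     x y = (O x × y ≡ 1) ⊎ (¬ O x × y ≡ 0)
Eval O (pairᶜ f g) x y =
  ∃[ u ] ∃[ v ] Eval O f x u × Eval O g x v × y ≡ ⟨ u , v ⟩
Eval O (compᶜ f g) x y = ∃[ u ] Eval O g x u × Eval O f u y
Eval O (precᶜ g h) x y = PrimRec (Eval O g) (Eval O h) (π₁ x) (π₂ x) y
Eval O (muᶜ f)     x y =
  Eval O f ⟨ x , y ⟩ 0 × (∀ k → k < y → ∃[ v ] Eval O f ⟨ x , k ⟩ (suc v))

Halts : Pred ℕ 0ℓ → Code → Pred ℕ 0ℓ
Halts O e x = ∃[ y ] Eval O e x y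

infix 4 _≤T_

_≤T_ : Rel (Pred ℕ 0ℓ) 0ℓ
A ≤T B = ∃[ e ] ∀ x → (A x → Eval B e x 1) × (¬ A x → Eval B e x 0)

-- Injective, as ⟨_,_⟩ is; numbers outside the image index no program.

encode : Code → ℕ
encode zeroᶜ       = ⟨ 0 , 0 ⟩
encode succᶜ       = ⟨ 1 , 0 ⟩
encode leftᶜ       = ⟨ 2 , 0 ⟩
encode rightᶜ      = ⟨ 3 , 0 ⟩
encode oracleᶜ     = ⟨ 4 , 0 ⟩
encode (pairᶜ f g) = ⟨ 5 , ⟨ encode f , encode g ⟩ ⟩
encode (compᶜ f g) = ⟨ 6 , ⟨ encode f , encode g ⟩ ⟩
encode (precᶜ g h) = ⟨ 7 , ⟨ encode g , encode h ⟩ ⟩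
encode (muᶜ f)     = ⟨ 8 , encode f ⟩

jump : Pred ℕ 0ℓ → Pred ℕ 0ℓ
jump X n = ∃[ e ] encode e ≡ n × Halts X e n

CEIn : Pred ℕ 0ℓ → Rel ℕ 0ℓ → Set
CEIn X R = ∃[ e ] ∀ x y → R x y ⇔ Halts X e ⟨ x , y ⟩

Directed : Rel ℕ 0ℓ → Pred ℕ 0ℓ → Set
Directed _≺_ P =
  ∃ P × (∀ x y → P x → P y → ∃[ z ] P z × x ≺ z × y ≺ z)

Interpolable : Rel ℕ 0ℓ → Set
Interpolable _≺_ = Transitive _≺_ × (∀ y → Directed _≺_ (λ x → x ≺ y))

-- With _≡_ as both underlying equalities this is a bijection that
-- preserves and reflects the relations; they need not be orders.

Isomorphic : Rel ℕ 0ℓ → Rel ℕ 0ℓ → Set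
Isomorphic R S = ∃[ f ] IsOrderIsomorphism _≡_ _≡_ R S f

{-# OPTIONS --safe #-}

-- Let B consist of the pairs ⟨ n , 1 ⟩ with n ∈ A and ⟨ n , 0 ⟩ with n ∉ A.
-- The relation is a fence of branches Z₀, Z₁, …, each a copy of the positive
-- rationals, where Z_m and Z_{m+1} are linked by a chain lying below both.
-- Maximal elements (tops) are put on Z_m, infinitely many at every natural
-- height, and infinitely many at height ∞ if m ∈ B, none otherwise.
--
-- If A ≤T X″, then m ∈ B ⇔ ∃p ∀t ∃r E(m,p,t,r) with E recursive in X.  In an
-- X-c.e. copy the top with index p on Z_m rises to height t once E has been
-- verified for all s < t.  A top that stops rising has a finite height, where
-- there are infinitely many tops anyway.  The Σ₃ form is obtained by running
-- programs on approximations to the jump, twice.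
--
-- Conversely, in an X-c.e. copy X″ computes an element u of each Z_m: an
-- element of Z_{m+2} is recognised by its common lower bounds with elements
-- of Z_m and Z_{m+1}.  A y above u has height ∞ iff it lies above all
-- non-maximal elements above u, which X″ decides.  So X″ decides A by
-- searching for such a y on the branches ⟨ n , 0 ⟩ and ⟨ n , 1 ⟩.

module Submission where

open import Axiom.ExcludedMiddle using (ExcludedMiddle)
open import Data.Empty using (⊥-elim)
open import Data.Nat
open import Data.Nat.Induction using (<-wellFounded)
open import Data.Nat.Properties
open import Data.Product using (∃; ∃-syntax; _×_; _,_; proj₁; proj₂)
open import Data.Sum as Sum using (_⊎_; inj₁; inj₂)
open import Function.Base using (_∘_; id)
open import Function.Bundles using (_⇔_; mk⇔; Equivalence)
open import Induction.WellFounded using (Acc; acc)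
open import Level using (0ℓ)
open import Relation.Binary.Core using (Rel)
open import Relation.Binary.Definitions using (Irreflexive; tri<; tri≈; tri>)
open import Relation.Binary.Morphism.Structures using (IsOrderIsomorphism)
open import Relation.Binary.PropositionalEquality
  using (_≡_; _≢_; refl; sym; trans; cong; cong₂; subst; subst₂; module ≡-Reasoning)
open import Relation.Nullary using (¬_; Dec; yes; no)
open import Relation.Unary using (Pred)
open import Defs

open Equivalence using (to; from)

-- A top of infinite height is a Σ₃ event over an X-c.e. copy, so a single branch per number could
-- only confirm membership. Coding the graph of the characteristic function makes both `A` and its
-- complement Σ₃, which matches reducibility to the double jump and makes the search for an answer
-- stop. The obstacle is that an isomorphism is arbitrary: a copy carries no labels, and its pairs
-- are enumerated, never withdrawn. The labels have to be readable from the order, and this is the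
-- purpose of the links: sharing a lower bound reveals that branches are neighbours. The links lie
-- below the branches and not above them, so that the non-maximal elements above a branch point all
-- belong to its own branch and heights can be measured from there. Each top sits on a dense line
-- because its lower set has to be directed. The domain has to be all of ℕ, so every kind from 2 on
-- is a chain, and each link is present in infinitely many copies. Quantifiers are counted strictly:
-- existential quantifiers in a row are merged into one search, since each jump pays for only one.

opaque
  -- Opaque, so that nested pairs are handled through the equations below and never evaluated to
  -- triangular numbers.
  pair : ℕ → ℕ → ℕ
  pair = ⟨_,_⟩

  fst snd : ℕ → ℕ
  fst = π₁
  snd = π₂

  pair≡⟨,⟩ : ∀ m n → pair m n ≡ ⟨ m , n ⟩
  pair≡⟨,⟩ m n = refl

  fst-pair : ∀ m n → fst (pair m n) ≡ m
  fst-pair m n = cong proj₁ (unpair-⟨,⟩ m n)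

  snd-pair : ∀ m n → snd (pair m n) ≡ n
  snd-pair m n = cong proj₂ (unpair-⟨,⟩ m n)

  -- `next` raises the code of a pair by exactly one, also where it moves to a new antidiagonal.
  pair-fst-snd : ∀ k → pair (fst k) (snd k) ≡ k
  pair-fst-snd zero    = refl
  pair-fst-snd (suc k) = trans (⟨next⟩ (unpair k)) (cong suc (pair-fst-snd k))
    where
    ⟨next⟩ : ∀ p → ⟨ proj₁ (next p) , proj₂ (next p) ⟩ ≡ suc ⟨ proj₁ p , proj₂ p ⟩
    ⟨next⟩ (zero  , n) = begin
      triangle (suc n + 0) + 0    ≡⟨ +-identityʳ _ ⟩
      triangle (suc n + 0)        ≡⟨ cong triangle (+-identityʳ (suc n)) ⟩
      suc (n + triangle n)        ≡⟨ cong suc (+-comm n (triangle n)) ⟩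
      suc (triangle n + n)        ∎
      where open ≡-Reasoning
    ⟨next⟩ (suc m , n) =
      trans (cong (λ s → triangle s + suc n) (+-suc m n)) (+-suc _ n)

  n≤pair : ∀ m n → n ≤ pair m n
  n≤pair m n = m≤n+m n (triangle (m + n))

pair-injective : ∀ {a b c d} → pair a b ≡ pair c d → a ≡ c × b ≡ d
pair-injective {a} {b} {c} {d} eq =
  trans (sym (fst-pair a b)) (trans (cong fst eq) (fst-pair c d)) ,
  trans (sym (snd-pair a b)) (trans (cong snd eq) (snd-pair c d))

-- Determinism of programs and injectivity of their numbering.

module _ {O : Pred ℕ 0ℓ} where

  Functional : Rel ℕ 0ℓ → Set
  Functional R = ∀ {x y z} → R x y → R x z → y ≡ z

  PrimRec-functional : ∀ {G H} → Functional G → Functional H →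
    ∀ {a} n {y z} → PrimRec G H a n y → PrimRec G H a n z → y ≡ z
  PrimRec-functional fg fh zero    p q = fg p q
  PrimRec-functional fg fh (suc n) (_ , p , p′) (_ , q , q′)
    with refl ← PrimRec-functional fg fh n p q = fh p′ q′

  Eval-functional : ∀ e {x y z} → Eval O e x y → Eval O e x z → y ≡ z
  Eval-functional zeroᶜ   p q = trans p (sym q)
  Eval-functional succᶜ   p q = trans p (sym q)
  Eval-functional leftᶜ   p q = trans p (sym q)
  Eval-functional rightᶜ  p q = trans p (sym q)
  Eval-functional oracleᶜ (inj₁ (_ , p)) (inj₁ (_ , q)) = trans p (sym q)
  Eval-functional oracleᶜ (inj₁ (i , _)) (inj₂ (o , _)) = ⊥-elim (o i)
  Eval-functional oracleᶜ (inj₂ (o , _)) (inj₁ (i , _)) = ⊥-elim (o i)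
  Eval-functional oracleᶜ (inj₂ (_ , p)) (inj₂ (_ , q)) = trans p (sym q)
  Eval-functional (pairᶜ f g) (_ , _ , p , p′ , eq) (_ , _ , q , q′ , eq′)
    with refl ← Eval-functional f p q | refl ← Eval-functional g p′ q′ = trans eq (sym eq′)
  Eval-functional (compᶜ f g) (_ , p , p′) (_ , q , q′)
    with refl ← Eval-functional g p q = Eval-functional f p′ q′
  Eval-functional (precᶜ g h) {x} p q =
    PrimRec-functional (Eval-functional g) (Eval-functional h) (π₂ x) p q
  Eval-functional (muᶜ f) {x} {y} {z} (p , p<) (q , q<) with <-cmp y z
  ... | tri≈ _ eq _ = eq
  -- At the smaller candidate one search reports zero and the other a positive value.
  ... | tri< y<z _ _ with () ← Eval-functional f p (proj₂ (q< y y<z))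
  ... | tri> _ _ z<y with () ← Eval-functional f q (proj₂ (p< z z<y))

tag body : Code → ℕ
tag zeroᶜ       = 0
tag succᶜ       = 1
tag leftᶜ       = 2
tag rightᶜ      = 3
tag oracleᶜ     = 4
tag (pairᶜ _ _) = 5
tag (compᶜ _ _) = 6
tag (precᶜ _ _) = 7
tag (muᶜ _)     = 8

body (pairᶜ f g) = pair (encode f) (encode g)
body (compᶜ f g) = pair (encode f) (encode g)
body (precᶜ g h) = pair (encode g) (encode h)
body (muᶜ f)     = encode f
body _           = 0

opaque
  unfolding pair

  encode≡pair : ∀ e → encode e ≡ pair (tag e) (body e)
  encode≡pair zeroᶜ       = refl
  encode≡pair succᶜ       = refl
  encode≡pair leftᶜ       = refl
  encode≡pair rightᶜ      = refl
  encode≡pair oracleᶜ     = refl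
  encode≡pair (pairᶜ _ _) = refl
  encode≡pair (compᶜ _ _) = refl
  encode≡pair (precᶜ _ _) = refl
  encode≡pair (muᶜ _)     = refl

mutual
  encode-injective : ∀ d e → encode d ≡ encode e → d ≡ e
  encode-injective d e eq =
    let t , b = pair-injective (trans (sym (encode≡pair d)) (trans eq (encode≡pair e)))
    in tag-body-injective d e t b

  tag-body-injective : ∀ d e → tag d ≡ tag e → body d ≡ body e → d ≡ e
  tag-body-injective zeroᶜ       zeroᶜ       _ _ = refl
  tag-body-injective succᶜ       succᶜ       _ _ = refl
  tag-body-injective leftᶜ       leftᶜ       _ _ = refl
  tag-body-injective rightᶜ      rightᶜ      _ _ = refl
  tag-body-injective oracleᶜ     oracleᶜ     _ _ = refl
  tag-body-injective (pairᶜ f g) (pairᶜ h k) _ b =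
    let p , q = pair-injective b in cong₂ pairᶜ (encode-injective f h p) (encode-injective g k q)
  tag-body-injective (compᶜ f g) (compᶜ h k) _ b =
    let p , q = pair-injective b in cong₂ compᶜ (encode-injective f h p) (encode-injective g k q)
  tag-body-injective (precᶜ f g) (precᶜ h k) _ b =
    let p , q = pair-injective b in cong₂ precᶜ (encode-injective f h p) (encode-injective g k q)
  tag-body-injective (muᶜ f)     (muᶜ g)     _ b = cong muᶜ (encode-injective f g b)

-- The given witness only bounds the search. Minimality is what `muᶜ` demands: positive values at
-- all earlier arguments.
least : ∀ {P : ℕ → Set} → (∀ n → Dec (P n)) → ∃ P →
  ∃[ n ] P n × (∀ k → k < n → ¬ P k)
least {P} P? (b , pb) = search b 0 (subst P (sym (+-identityʳ b)) pb) (λ _ ())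
  where
  -- `d` is the distance left from `k` to the given witness.
  search : ∀ d k → P (d + k) → (∀ i → i < k → ¬ P i) → ∃[ n ] P n × (∀ i → i < n → ¬ P i)
  search zero    k p none = k , p , none
  search (suc d) k p none with P? k
  ... | yes pk = k , pk , none
  ... | no ¬pk = search d (suc k) (subst P (sym (+-suc d k)) p) none′
    where
    none′ : ∀ i → i < suc k → ¬ P i
    none′ i (s≤s i≤k) with m≤n⇒m<n∨m≡n i≤k
    ... | inj₁ i<k  = none i i<k
    ... | inj₂ refl = ¬pk

-- Functions computable, and predicates decidable, in an oracle

rec : ℕ → (ℕ → ℕ → ℕ) → ℕ → ℕ
rec z s zero    = z
rec z s (suc n) = s n (rec z s n)

ifz : ℕ → ℕ → ℕ → ℕ
ifz zero    a b = a
ifz (suc _) a b = b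

constᶜ : ℕ → Code
constᶜ zero    = zeroᶜ
constᶜ (suc n) = compᶜ succᶜ (constᶜ n)

record Computable (O : Pred ℕ 0ℓ) (F : ℕ → ℕ) : Set where
  constructor computes
  field
    code      : Code
    evaluates : ∀ x → Eval O code x (F x)

-- Wrapped in a record because unification cannot recover `F` from `F (fst z) (snd z)`.
record Computable₂ (O : Pred ℕ 0ℓ) (F : ℕ → ℕ → ℕ) : Set where
  constructor curried
  field
    uncurried : Computable O (λ z → F (fst z) (snd z))

module _ {O : Pred ℕ 0ℓ} where

  Eval-const : ∀ n x → Eval O (constᶜ n) x n
  Eval-const zero    x = refl
  Eval-const (suc n) x = n , Eval-const n x , refl

  const-computable : ∀ n → Computable O (λ _ → n)
  const-computable n = computes (constᶜ n) (Eval-const n)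

  suc-computable : Computable O suc
  suc-computable = computes succᶜ λ _ → refl

  computable-cong : ∀ {F G : ℕ → ℕ} → (∀ x → F x ≡ G x) → Computable O F → Computable O G
  computable-cong eq (computes e p) = computes e λ x → subst (Eval O e x) (eq x) (p x)

  infixr 9 _⊙_
  _⊙_ : ∀ {F G} → Computable O F → Computable O G → Computable O (λ x → F (G x))
  _⊙_ {G = G} (computes f p) (computes g q) = computes (compᶜ f g) λ x → G x , q x , p (G x)

  opaque
    unfolding pair

    fst-computable : Computable O fst
    fst-computable = computes leftᶜ λ _ → refl

    snd-computable : Computable O snd
    snd-computable = computes rightᶜ λ _ → refl

    pair-computable : ∀ {F G} → Computable O F → Computable O G → Computable O (λ x → pair (F x) (G x))
    pair-computable {F} {G} (computes f p) (computes g q) =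
      computes (pairᶜ f g) λ x → F x , G x , p x , q x , refl

    rec-graph : ∀ g h (G H : ℕ → ℕ) → (∀ x → Eval O g x (G x)) → (∀ x → Eval O h x (H x)) →
      ∀ a n → PrimRec (Eval O g) (Eval O h) a n (rec (G a) (λ k r → H (pair a (pair k r))) n)
    rec-graph g h G H p q a zero    = p a
    rec-graph g h G H p q a (suc n) = _ , rec-graph g h G H p q a n , q _

    rec-computable′ : ∀ {G H} → Computable O G → Computable O H →
      Computable O (λ z → rec (G (fst z)) (λ k r → H (pair (fst z) (pair k r))) (snd z))
    rec-computable′ {G} {H} (computes g p) (computes h q) =
      computes (precᶜ g h) λ z → rec-graph g h G H p q (fst z) (snd z)

    μ-computable : ∀ {F} → Computable O F → (∀ x → ∃[ y ] F (pair x y) ≡ 0) →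
      ∃[ M ] Computable O M × (∀ x → F (pair x (M x)) ≡ 0)
    μ-computable {F} (computes f p) total =
      (λ x → proj₁ (min x)) , computes (muᶜ f) evaluates , λ x → proj₁ (proj₂ (min x))
      where
      min : ∀ x → ∃[ y ] F (pair x y) ≡ 0 × (∀ k → k < y → ¬ F (pair x k) ≡ 0)
      min x = least (λ y → F (pair x y) ≟ 0) (total x)
      evaluates : ∀ x → Eval O (muᶜ f) x (proj₁ (min x))
      evaluates x with y , z , nz ← min x =
        subst (Eval O f _) z (p _) ,
        λ k k<y → pred (F (pair x k)) ,
          subst (Eval O f _) (sym (suc-pred _ {{≢-nonZero (nz k k<y)}})) (p _)

    -- The test is total, so no undefined earlier value can block the search, and halting is exactly
    -- an existential quantifier.
    halts-search : ∀ {F} → Computable O F → ∃[ e ] ∀ x → (∃[ y ] F (pair x y) ≡ 0) ⇔ Halts O e x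
    halts-search {F} (computes f p) = muᶜ f , λ x → mk⇔
      (λ ex → let y , z , nz = least (λ y → F (pair x y) ≟ 0) ex in
        y , subst (Eval O f _) z (p _) ,
        λ k k<y → pred (F (pair x k)) ,
          subst (Eval O f _) (sym (suc-pred _ {{≢-nonZero (nz k k<y)}})) (p _))
      (λ (y , z , _) → y , Eval-functional f (p _) z)

  id-computable : Computable O id
  id-computable = computable-cong pair-fst-snd (pair-computable fst-computable snd-computable)

  ap₂ : ∀ {F U V} → Computable₂ O F → Computable O U → Computable O V → Computable O (λ x → F (U x) (V x))
  ap₂ {F} {U} {V} (curried f) u v = computable-cong
    (λ x → cong₂ F (fst-pair (U x) (V x)) (snd-pair (U x) (V x))) (f ⊙ pair-computable u v)

  rec-cong : ∀ z {s s′ : ℕ → ℕ → ℕ} → (∀ k r → s k r ≡ s′ k r) → ∀ n → rec z s n ≡ rec z s′ n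
  rec-cong z eq zero    = refl
  rec-cong z {s} eq (suc n) = trans (cong (s n) (rec-cong z eq n)) (eq n _)

  rec-computable : ∀ {G N : ℕ → ℕ} {H : ℕ → ℕ → ℕ → ℕ} → Computable O G →
    Computable O (λ z → H (fst z) (fst (snd z)) (snd (snd z))) → Computable O N →
    Computable O (λ x → rec (G x) (H x) (N x))
  rec-computable {G} {N} {H} g h n = computable-cong
    (λ x → trans
      (cong₂ (λ a k → rec (G a) (λ k r → H′ (pair a (pair k r))) k) (fst-pair x (N x)) (snd-pair x (N x)))
      (rec-cong (G x) (unpacked x) (N x)))
    (rec-computable′ {H = H′} g h ⊙ pair-computable id-computable n)
    where
    H′ : ℕ → ℕ
    H′ z = H (fst z) (fst (snd z)) (snd (snd z))
    unpacked : ∀ x k r → H′ (pair x (pair k r)) ≡ H x k r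
    unpacked x k r rewrite fst-pair x (pair k r) | snd-pair x (pair k r) | fst-pair k r | snd-pair k r = refl

  iterate-computable : ∀ {G N : ℕ → ℕ} {H : ℕ → ℕ → ℕ} → Computable O G → Computable₂ O H → Computable O N →
    Computable O (λ x → rec (G x) (λ _ → H x) (N x))
  iterate-computable {H = H} g h n =
    rec-computable {H = λ x _ → H x} g
      (ap₂ {F = H} h fst-computable (snd-computable ⊙ snd-computable)) n

  ifz-computable : ∀ {C F G} → Computable O C → Computable O F → Computable O G →
    Computable O (λ x → ifz (C x) (F x) (G x))
  ifz-computable {C} {F} {G} c f g = computable-cong (λ x → lemma x (C x))
    (rec-computable {H = λ x _ _ → G x} f (g ⊙ fst-computable) c)
    where
    lemma : ∀ x n → rec (F x) (λ _ _ → G x) n ≡ ifz n (F x) (G x)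
    lemma x zero    = refl
    lemma x (suc n) = refl

  pred-computable : Computable O pred
  pred-computable = computable-cong lemma
    (rec-computable {H = λ _ k _ → k} (const-computable 0) (fst-computable ⊙ snd-computable) id-computable)
    where
    lemma : ∀ n → rec 0 (λ k _ → k) n ≡ pred n
    lemma zero    = refl
    lemma (suc n) = refl

  +-computable : Computable₂ O _+_
  +-computable = curried (computable-cong (λ z → lemma (snd z) (fst z))
    (iterate-computable {H = λ _ r → suc r} snd-computable
      (curried (suc-computable ⊙ snd-computable)) fst-computable))
    where
    lemma : ∀ b n → rec b (λ _ r → suc r) n ≡ n + b
    lemma b zero    = refl
    lemma b (suc n) = cong suc (lemma b n)

  *-computable : Computable₂ O _*_
  *-computable = curried (computable-cong (λ z → lemma (snd z) (fst z))
    (iterate-computable {H = λ z r → snd z + r} (const-computable 0)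
      (curried (ap₂ +-computable (snd-computable ⊙ fst-computable) snd-computable)) fst-computable))
    where
    lemma : ∀ b n → rec 0 (λ _ r → b + r) n ≡ n * b
    lemma b zero    = refl
    lemma b (suc n) = cong (b +_) (lemma b n)

  ∸-computable : Computable₂ O _∸_
  ∸-computable = curried (computable-cong (λ z → lemma (fst z) (snd z))
    (iterate-computable {H = λ _ r → pred r} fst-computable
      (curried (pred-computable ⊙ snd-computable)) snd-computable))
    where
    lemma : ∀ a n → rec a (λ _ r → pred r) n ≡ a ∸ n
    lemma a zero    = refl
    lemma a (suc n) = trans (cong pred (lemma a n)) (pred[m∸n]≡m∸[1+n] a n)

-- The value 0 stands for truth, so that _+_ is conjunction, _*_ is
-- disjunction, and the μ-operator searches for truth.
record Recursive (O P : Pred ℕ 0ℓ) : Set where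
  constructor recursive
  field
    value      : ℕ → ℕ
    computable : Computable O value
    correct    : ∀ x → P x ⇔ value x ≡ 0

module _ {O : Pred ℕ 0ℓ} where

  recursive-dec : ∀ {P} → Recursive O P → ∀ x → Dec (P x)
  recursive-dec (recursive F _ spec) x with F x ≟ 0
  ... | yes z = yes (from (spec x) z)
  ... | no nz = no (nz ∘ to (spec x))

  recursive-cong : ∀ {P Q} → (∀ x → P x ⇔ Q x) → Recursive O P → Recursive O Q
  recursive-cong eq (recursive F f spec) = recursive F f λ x →
    mk⇔ (to (spec x) ∘ from (eq x)) (to (eq x) ∘ from (spec x))

  infixl 8 _⟪_⟫
  _⟪_⟫ : ∀ {P U} → Recursive O P → Computable O U → Recursive O (λ x → P (U x))
  _⟪_⟫ {U = U} (recursive F f spec) u = recursive (F ∘ U) (f ⊙ u) λ x → spec (U x)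

  infixr 6 _∧ʳ_
  infixr 5 _∨ʳ_

  _∧ʳ_ : ∀ {P Q} → Recursive O P → Recursive O Q → Recursive O (λ x → P x × Q x)
  (recursive F f p) ∧ʳ (recursive G g q) = recursive (λ x → F x + G x) (ap₂ +-computable f g) λ x → mk⇔
    (λ (u , v) → cong₂ _+_ (to (p x) u) (to (q x) v))
    (λ z → from (p x) (m+n≡0⇒m≡0 (F x) z) , from (q x) (m+n≡0⇒n≡0 (F x) z))

  _∨ʳ_ : ∀ {P Q} → Recursive O P → Recursive O Q → Recursive O (λ x → P x ⊎ Q x)
  (recursive F f p) ∨ʳ (recursive G g q) = recursive (λ x → F x * G x) (ap₂ *-computable f g) λ x → mk⇔
    (λ { (inj₁ u) → cong (_* G x) (to (p x) u)
       ; (inj₂ v) → trans (cong (F x *_) (to (q x) v)) (*-zeroʳ (F x)) })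
    (λ z → Sum.map (from (p x)) (from (q x)) (m*n≡0⇒m≡0∨n≡0 (F x) z))

  ¬ʳ_ : ∀ {P} → Recursive O P → Recursive O (λ x → ¬ P x)
  ¬ʳ (recursive F f p) = recursive (λ x → 1 ∸ F x) (ap₂ ∸-computable (const-computable 1) f) λ x → mk⇔
    (λ np → positive (F x) (np ∘ from (p x)))
    (λ z px → 1+n≢0 (trans (cong (1 ∸_) (sym (to (p x) px))) z))
    where
    positive : ∀ n → ¬ n ≡ 0 → 1 ∸ n ≡ 0
    positive zero    nz = ⊥-elim (nz refl)
    positive (suc n) nz = 0∸n≡0 n

  ≤ʳ : ∀ {U V} → Computable O U → Computable O V → Recursive O (λ x → U x ≤ V x)
  ≤ʳ u v = recursive _ (ap₂ ∸-computable u v) λ x → mk⇔ m≤n⇒m∸n≡0 m∸n≡0⇒m≤n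

  <ʳ : ∀ {U V} → Computable O U → Computable O V → Recursive O (λ x → U x < V x)
  <ʳ u v = ≤ʳ (suc-computable ⊙ u) v

  ≡ʳ : ∀ {U V} → Computable O U → Computable O V → Recursive O (λ x → U x ≡ V x)
  ≡ʳ u v = recursive-cong
    (λ x → mk⇔ (λ (p , q) → ≤-antisym p q) (λ eq → ≤-reflexive eq , ≤-reflexive (sym eq)))
    (≤ʳ u v ∧ʳ ≤ʳ v u)

  choiceʳ : ∀ {P : ℕ → ℕ → Set} → Recursive O (λ z → P (fst z) (snd z)) → (∀ x → ∃ (P x)) →
    ∃[ M ] Computable O M × (∀ x → P x (M x))
  choiceʳ {P} (recursive F f p) total =
    let M , m , zero-at = μ-computable f λ x → let y , pxy = total x in y ,
          to (p _) (subst₂ P (sym (fst-pair x y)) (sym (snd-pair x y)) pxy)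
    in M , m , λ x → subst₂ P (fst-pair x (M x)) (snd-pair x (M x)) (from (p _) (zero-at x))

  ∃-halts : ∀ {P : ℕ → ℕ → Set} → Recursive O (λ z → P (fst z) (snd z)) →
    ∃[ e ] ∀ x → ∃ (P x) ⇔ Halts O e x
  ∃-halts {P} (recursive F f p) =
    let e , h = halts-search f in e , λ x → mk⇔
      (λ (y , pxy) → to (h x) (y , to (p _) (subst₂ P (sym (fst-pair x y)) (sym (snd-pair x y)) pxy)))
      (λ hx → let y , z = from (h x) hx in y , subst₂ P (fst-pair x y) (snd-pair x y) (from (p _) z))

-- Halting problems as questions to the jump.

freeze : Code → ℕ → Code
freeze e x = compᶜ e (constᶜ x)

encode-comp : ∀ f g → encode (compᶜ f g) ≡ pair 6 (pair (encode f) (encode g))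
encode-comp f g = encode≡pair (compᶜ f g)

freeze-computable : ∀ {O} e → Computable O (λ x → encode (freeze e x))
freeze-computable e = computable-cong
  (λ x → trans (cong (comp-with e) (lemma x)) (sym (encode-comp e (constᶜ x))))
  (comp-with-computable e (iterate-computable {H = λ _ → comp-with succᶜ}
    (const-computable (encode zeroᶜ)) (curried (comp-with-computable succᶜ snd-computable)) id-computable))
  where
  comp-with : Code → ℕ → ℕ
  comp-with f r = pair 6 (pair (encode f) r)
  comp-with-computable : ∀ {O} f {G} → Computable O G → Computable O (λ x → comp-with f (G x))
  comp-with-computable f g =
    pair-computable (const-computable 6) (pair-computable (const-computable (encode f)) g)
  lemma : ∀ n → rec (encode zeroᶜ) (λ _ → comp-with succᶜ) n ≡ encode (constᶜ n)
  lemma zero    = refl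
  lemma (suc n) = trans (cong (comp-with succᶜ) (lemma n)) (sym (encode-comp succᶜ (constᶜ n)))

-- `jump` runs a program on its own number. A frozen program discards that input in favour of the
-- built-in `x`, which is the s-m-n argument.
jump-freeze : ∀ {O} e x → jump O (encode (freeze e x)) ⇔ Halts O e x
jump-freeze {O} e x = mk⇔
  (λ (d , eq , h) → unfreeze (subst (λ c → Halts O c _) (encode-injective d (freeze e x) eq) h))
  (λ (y , h) → freeze e x , refl , y , x , Eval-const x _ , h)
  where
  unfreeze : ∀ {n} → Halts O (freeze e x) n → Halts O e x
  unfreeze (y , u , c , h) = y , subst (λ u → Eval O e u y) (Eval-functional (constᶜ x) c (Eval-const x _)) h

module Classical (em : ExcludedMiddle 0ℓ) where

  χ : Pred ℕ 0ℓ → ℕ → ℕ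
  χ O x with em {O x}
  ... | yes _ = 1
  ... | no  _ = 0

  χ-spec : ∀ O x → (O x × χ O x ≡ 1) ⊎ (¬ O x × χ O x ≡ 0)
  χ-spec O x with em {O x}
  ... | yes p = inj₁ (p , refl)
  ... | no np = inj₂ (np , refl)

  χ-computable : ∀ {O} → Computable O (χ O)
  χ-computable {O} = computes oracleᶜ (χ-spec O)

  oracleʳ : ∀ {O} → Recursive O O
  oracleʳ {O} = recursive-cong (λ x → mk⇔ (holds x) (value x)) (≡ʳ χ-computable (const-computable 1))
    where
    holds : ∀ x → χ O x ≡ 1 → O x
    holds x eq with χ-spec O x
    ... | inj₁ (p , _) = p
    ... | inj₂ (_ , z) with () ← trans (sym eq) z
    value : ∀ x → O x → χ O x ≡ 1
    value x p with χ-spec O x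
    ... | inj₁ (_ , o) = o
    ... | inj₂ (n , _) = ⊥-elim (n p)

  halts-jump : ∀ {O} e → Recursive (jump O) (Halts O e)
  halts-jump e = recursive-cong (jump-freeze e) (oracleʳ ⟪ freeze-computable e ⟫)

  -- One existential quantifier costs one jump, since an unbounded search is a halting problem.
  ∃ʳ : ∀ {O} {P : ℕ → ℕ → Set} → Recursive O (λ z → P (fst z) (snd z)) → Recursive (jump O) (λ x → ∃ (P x))
  ∃ʳ r = let e , h = ∃-halts r in recursive-cong (λ x → mk⇔ (from (h x)) (to (h x))) (halts-jump e)

  -- A vacuous quantifier turns this into an instance of `∃ʳ`.
  jumpʳ : ∀ {O P} → Recursive O P → Recursive (jump O) P
  jumpʳ {P = P} r = recursive-cong (λ x → mk⇔ (λ (_ , p) → p) (λ p → 0 , p))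
    (∃ʳ {P = λ x _ → P x} (r ⟪ fst-computable ⟫))

-- A universal interpreter for oracle programs.

module _ {O : Pred ℕ 0ℓ} where
  opaque
    unfolding pair

    eval-left : ∀ {x y} → Eval O leftᶜ x y ⇔ y ≡ fst x
    eval-left = mk⇔ id id

    eval-right : ∀ {x y} → Eval O rightᶜ x y ⇔ y ≡ snd x
    eval-right = mk⇔ id id

    eval-pair : ∀ f g {x y} →
      Eval O (pairᶜ f g) x y ⇔ (∃[ u ] ∃[ v ] Eval O f x u × Eval O g x v × y ≡ pair u v)
    eval-pair f g = mk⇔ id id

    eval-prec-zero : ∀ g h {x y} → snd x ≡ 0 → Eval O (precᶜ g h) x y ⇔ Eval O g (fst x) y
    eval-prec-zero g h {x} {y} eq = mk⇔
      (subst (λ n → PrimRec (Eval O g) (Eval O h) (fst x) n y) eq)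
      (subst (λ n → PrimRec (Eval O g) (Eval O h) (fst x) n y) (sym eq))

    -- Stated with `precᶜ` at the smaller argument instead of `PrimRec`, since this is how the
    -- machine recurses.
    eval-prec-suc : ∀ g h {x y n} → snd x ≡ suc n → Eval O (precᶜ g h) x y ⇔
      (∃[ r ] Eval O (precᶜ g h) (pair (fst x) n) r × Eval O h (pair (fst x) (pair n r)) y)
    eval-prec-suc g h {x} {y} {n} eq = mk⇔
      (λ p → let r , p₁ , p₂ = subst graph eq p in r , subst id (sym (unpack r)) p₁ , p₂)
      (λ (r , p₁ , p₂) → subst graph (sym eq) (r , subst id (unpack r) p₁ , p₂))
      where
      graph : ℕ → Set
      graph n = PrimRec (Eval O g) (Eval O h) (fst x) n y
      unpack : ∀ r → Eval O (precᶜ g h) (pair (fst x) n) r ≡ PrimRec (Eval O g) (Eval O h) (fst x) n r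
      unpack r = cong₂ (λ a k → PrimRec (Eval O g) (Eval O h) a k r) (fst-pair (fst x) n) (snd-pair (fst x) n)

    eval-mu : ∀ f {x y} → Eval O (muᶜ f) x y ⇔
      (Eval O f (pair x y) 0 × (∀ k → k < y → ∃[ v ] Eval O f (pair x k) (suc v)))
    eval-mu f = mk⇔ id id

-- A stack machine: `pair K v` holds a stack K of frames and a value v.  A
-- frame is a pair of a tag and data; a frame with tag < 9 is the number of a
-- program, to be applied to v.  The tags 9, 10 await the two values of a
-- pairᶜ, 11 the recursive value of a precᶜ, 12 a value tested by a muᶜ, and
-- 13 checks that its data is the number of a program.

cons : ℕ → ℕ → ℕ
cons f K = suc (pair f K)

act : ℕ → ℕ → ℕ → ℕ → ℕ → ℕ
act q t r K v =
  -- The tests are nested: `t ∸ n` is reached only for t ≥ n, so it vanishes exactly at t = n.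
  ifz t        (pair K 0) (
  ifz (t ∸ 1)  (pair K (suc v)) (
  ifz (t ∸ 2)  (pair K (fst v)) (
  ifz (t ∸ 3)  (pair K (snd v)) (
  ifz (t ∸ 4)  (pair K q) (
  ifz (t ∸ 5)  (pair (cons (fst r) (cons (pair 9 (pair (snd r) v)) K)) v) (
  ifz (t ∸ 6)  (pair (cons (snd r) (cons (fst r) K)) v) (
  ifz (t ∸ 7)  (ifz (snd v)
                 (pair (cons (fst r) K) (fst v))
                 -- The same `precᶜ` frame goes back on the stack with the counter lowered; the
                 -- frame 11 beneath it keeps what the step program will need.
                 (pair (cons (pair 7 r) (cons (pair 11 (pair (snd r) (pair (fst v) (pred (snd v))))) K))
                       (pair (fst v) (pred (snd v))))) (
  ifz (t ∸ 8)  (pair (cons r (cons (pair 12 (pair r (pair v 0))) K)) (pair v 0)) (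
  ifz (t ∸ 9)  (pair (cons (fst r) (cons (pair 10 v) K)) (snd r)) (
  ifz (t ∸ 10) (pair K (pair r v)) (
  ifz (t ∸ 11) (pair (cons (fst r) K) (pair (fst (snd r)) (pair (snd (snd r)) v))) (
  ifz (t ∸ 12) (ifz v
                 (pair K (snd (snd r)))
                 (pair (cons (fst r) (cons (pair 12 (pair (fst r) (pair (fst (snd r)) (suc (snd (snd r)))))) K))
                       (pair (fst (snd r)) (suc (snd (snd r)))))) (
  -- Tag 13, split by the tag of the number under test: up to 4 its body must be 0, from 5 to 7 it
  -- has two subprograms, at 8 one. Otherwise the state is restored, so an invalid number makes the
  -- machine loop.
  ifz (fst r ∸ 4) (ifz (snd r) (pair K v) (pair (cons (pair t r) K) v)) (
  ifz (fst r ∸ 7) (pair (cons (pair 13 (fst (snd r))) (cons (pair 13 (snd (snd r))) K)) v) (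
  ifz (fst r ∸ 8) (pair (cons (pair 13 (snd r)) K) v)
                  (pair (cons (pair t r) K) v))))))))))))))))

step : (ℕ → ℕ) → ℕ → ℕ
step o s = ifz (fst s) s
  (act (o (snd s)) (fst (fst (pred (fst s)))) (snd (fst (pred (fst s)))) (snd (pred (fst s))) (snd s))

run : (ℕ → ℕ) → ℕ → ℕ → ℕ
run o n s = rec s (λ _ → step o) n

module _ {O : Pred ℕ 0ℓ} where

  act-computable : ∀ {Q T R K V} → Computable O Q → Computable O T → Computable O R →
    Computable O K → Computable O V → Computable O (λ x → act (Q x) (T x) (R x) (K x) (V x))
  act-computable {T = T} {R} q t r k v =
    ifz-computable t (k ▹ const-computable 0) (
    at 1 (k ▹ suc-computable ⊙ v) (
    at 2 (k ▹ fst-computable ⊙ v) (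
    at 3 (k ▹ snd-computable ⊙ v) (
    at 4 (k ▹ q) (
    at 5 (cons-computable r₁ (cons-computable (frame 9 (r₂ ▹ v)) k) ▹ v) (
    at 6 (cons-computable r₂ (cons-computable r₁ k) ▹ v) (
    at 7 (ifz-computable v₂
             (cons-computable r₁ k ▹ v₁)
             (cons-computable (frame 7 r) (cons-computable (frame 11 (r₂ ▹ v₁ ▹ pred-computable ⊙ v₂)) k)
              ▹ v₁ ▹ pred-computable ⊙ v₂)) (
    at 8 (cons-computable r (cons-computable (frame 12 (r ▹ v ▹ const-computable 0)) k)
           ▹ v ▹ const-computable 0) (
    at 9 (cons-computable r₁ (cons-computable (frame 10 v) k) ▹ r₂) (
    at 10 (k ▹ r ▹ v) (
    at 11 (cons-computable r₁ k ▹ r₂₁ ▹ r₂₂ ▹ v) (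
    at 12 (ifz-computable v
             (k ▹ r₂₂)
             (cons-computable r₁ (cons-computable (frame 12 (r₁ ▹ r₂₁ ▹ suc-computable ⊙ r₂₂)) k)
              ▹ r₂₁ ▹ suc-computable ⊙ r₂₂)) (
    check-at 4 (ifz-computable r₂ (k ▹ v) (cons-computable (t ▹ r) k ▹ v)) (
    check-at 7 (cons-computable (frame 13 r₂₁) (cons-computable (frame 13 r₂₂) k) ▹ v) (
    check-at 8 (cons-computable (frame 13 r₂) k ▹ v)
             (cons-computable (t ▹ r) k ▹ v))))))))))))))))
    where
    infixr 5 _▹_
    _▹_ : ∀ {F G} → Computable O F → Computable O G → Computable O (λ x → pair (F x) (G x))
    _▹_ = pair-computable
    cons-computable : ∀ {F G} → Computable O F → Computable O G → Computable O (λ x → cons (F x) (G x))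
    cons-computable f g = suc-computable ⊙ pair-computable f g
    frame : ∀ n {F} → Computable O F → Computable O (λ x → pair n (F x))
    frame n f = const-computable n ▹ f
    r₁ = fst-computable ⊙ r
    r₂ = snd-computable ⊙ r
    r₂₁ = fst-computable ⊙ r₂
    r₂₂ = snd-computable ⊙ r₂
    v₁ = fst-computable ⊙ v
    v₂ = snd-computable ⊙ v
    at : ∀ n {F G} → Computable O F → Computable O G → Computable O (λ x → ifz (T x ∸ n) (F x) (G x))
    at n = ifz-computable (ap₂ ∸-computable t (const-computable n))
    check-at : ∀ n {F G} → Computable O F → Computable O G → Computable O (λ x → ifz (fst (R x) ∸ n) (F x) (G x))
    check-at n = ifz-computable (ap₂ ∸-computable (fst-computable ⊙ r) (const-computable n))

  run-computable : ∀ {o : ℕ → ℕ → ℕ} {N S : ℕ → ℕ} → Computable₂ O o → Computable O N → Computable O S →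
    Computable O (λ x → run (o x) (N x) (S x))
  run-computable {o} o-computable n s = iterate-computable {H = λ x → step (o x)} s
    (curried (ifz-computable k s′
      (act-computable (ap₂ o-computable fst-computable (snd-computable ⊙ s′))
        (fst-computable ⊙ fst-computable ⊙ pred-computable ⊙ k)
        (snd-computable ⊙ fst-computable ⊙ pred-computable ⊙ k)
        (snd-computable ⊙ pred-computable ⊙ k)
        (snd-computable ⊙ s′)))) n
    where
    s′ = snd-computable
    k = fst-computable ⊙ s′

-- Correctness of the interpreter.

module Steps (o : ℕ → ℕ) where

  run-suc : ∀ n s → run o (suc n) s ≡ run o n (step o s)
  run-suc zero    s = refl
  run-suc (suc n) s = cong (step o) (run-suc n s)

  halted-step : ∀ {s} → fst s ≡ 0 → step o s ≡ s
  halted-step {s} eq rewrite eq = refl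

  run-halted : ∀ m n {s} → fst (run o n s) ≡ 0 → run o (m + n) s ≡ run o n s
  run-halted zero    n eq = refl
  run-halted (suc m) n {s} eq = trans (cong (step o) (run-halted m n eq)) (halted-step eq)

  infix 4 _↠_
  _↠_ : ℕ → ℕ → Set
  s ↠ s′ = ∃[ n ] run o n s ≡ s′

  stop : ∀ {s} → s ↠ s
  stop = 0 , refl

  infixr 5 _◅_ _◅◅_
  _◅_ : ∀ {s s′ s″} → step o s ≡ s′ → s′ ↠ s″ → s ↠ s″
  _◅_ {s} eq (n , p) = suc n , trans (run-suc n s) (trans (cong (run o n) eq) p)

  _◅◅_ : ∀ {s s′ s″} → s ↠ s′ → s′ ↠ s″ → s ↠ s″
  (n , p) ◅◅ q = go n p
    where
    go : ∀ n {s} → run o n s ≡ _ → s ↠ _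
    go zero    p = subst (_↠ _) (sym p) q
    go (suc n) p = refl ◅ go n (trans (sym (run-suc n _)) p)

  step-cons : ∀ t r K v → step o (pair (cons (pair t r) K) v) ≡ act (o v) t r K v
  step-cons t r K v
    rewrite fst-pair (cons (pair t r) K) v | snd-pair (cons (pair t r) K) v
          | fst-pair (pair t r) K | snd-pair (pair t r) K | fst-pair t r | snd-pair t r = refl

  step-code : ∀ e K v → step o (pair (cons (encode e) K) v) ≡ act (o v) (tag e) (body e) K v
  step-code e K v =
    trans (cong (λ c → step o (pair (cons c K) v)) (encode≡pair e)) (step-cons (tag e) (body e) K v)

  step-pair : ∀ f g K v → step o (pair (cons (encode (pairᶜ f g)) K) v) ≡
    pair (cons (encode f) (cons (pair 9 (pair (encode g) v)) K)) v
  step-pair f g K v = trans (step-code (pairᶜ f g) K v)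
    (cong₂ (λ a b → pair (cons a (cons (pair 9 (pair b v)) K)) v) (fst-pair _ _) (snd-pair _ _))

  step-comp : ∀ f g K v → step o (pair (cons (encode (compᶜ f g)) K) v) ≡
    pair (cons (encode g) (cons (encode f) K)) v
  step-comp f g K v = trans (step-code (compᶜ f g) K v)
    (cong₂ (λ a b → pair (cons b (cons a K)) v) (fst-pair _ _) (snd-pair _ _))

  step-prec-zero : ∀ g h K v → snd v ≡ 0 → step o (pair (cons (encode (precᶜ g h)) K) v) ≡
    pair (cons (encode g) K) (fst v)
  step-prec-zero g h K v eq = trans (step-code (precᶜ g h) K v) lemma
    where
    lemma : act (o v) 7 (pair (encode g) (encode h)) K v ≡ pair (cons (encode g) K) (fst v)
    lemma rewrite eq = cong (λ a → pair (cons a K) (fst v)) (fst-pair _ _)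

  step-prec-suc : ∀ g h K v n → snd v ≡ suc n → step o (pair (cons (encode (precᶜ g h)) K) v) ≡
    pair (cons (encode (precᶜ g h)) (cons (pair 11 (pair (encode h) (pair (fst v) n))) K)) (pair (fst v) n)
  step-prec-suc g h K v n eq = trans (step-code (precᶜ g h) K v) lemma
    where
    lemma : act (o v) 7 (pair (encode g) (encode h)) K v ≡
      pair (cons (encode (precᶜ g h)) (cons (pair 11 (pair (encode h) (pair (fst v) n))) K)) (pair (fst v) n)
    lemma rewrite eq = cong₂
      (λ a b → pair (cons a (cons (pair 11 (pair b (pair (fst v) n))) K)) (pair (fst v) n))
      (sym (encode≡pair (precᶜ g h))) (snd-pair _ _)

  step-mu : ∀ f K v → step o (pair (cons (encode (muᶜ f)) K) v) ≡
    pair (cons (encode f) (cons (pair 12 (pair (encode f) (pair v 0))) K)) (pair v 0)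
  step-mu f K v = step-code (muᶜ f) K v

  step-pair₁ : ∀ g x K u → step o (pair (cons (pair 9 (pair g x)) K) u) ≡
    pair (cons g (cons (pair 10 u) K)) x
  step-pair₁ g x K u = trans (step-cons 9 (pair g x) K u)
    (cong₂ (λ a b → pair (cons a (cons (pair 10 u) K)) b) (fst-pair _ _) (snd-pair _ _))

  step-pair₂ : ∀ u K v → step o (pair (cons (pair 10 u) K) v) ≡ pair K (pair u v)
  step-pair₂ u K v = step-cons 10 u K v

  step-prec : ∀ h a n K v → step o (pair (cons (pair 11 (pair h (pair a n))) K) v) ≡
    pair (cons h K) (pair a (pair n v))
  step-prec h a n K v = trans (step-cons 11 (pair h (pair a n)) K v) lemma
    where
    lemma : act (o v) 11 (pair h (pair a n)) K v ≡ pair (cons h K) (pair a (pair n v))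
    lemma rewrite fst-pair h (pair a n) | snd-pair h (pair a n) | fst-pair a n | snd-pair a n = refl

  step-mu-zero : ∀ f x k K → step o (pair (cons (pair 12 (pair f (pair x k))) K) 0) ≡ pair K k
  step-mu-zero f x k K = trans (step-cons 12 (pair f (pair x k)) K 0)
    (cong (pair K) (trans (cong snd (snd-pair _ _)) (snd-pair _ _)))

  step-mu-suc : ∀ f x k K v → step o (pair (cons (pair 12 (pair f (pair x k))) K) (suc v)) ≡
    pair (cons f (cons (pair 12 (pair f (pair x (suc k)))) K)) (pair x (suc k))
  step-mu-suc f x k K v = trans (step-cons 12 (pair f (pair x k)) K (suc v)) lemma
    where
    lemma : act (o (suc v)) 12 (pair f (pair x k)) K (suc v) ≡
      pair (cons f (cons (pair 12 (pair f (pair x (suc k)))) K)) (pair x (suc k))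
    lemma rewrite fst-pair f (pair x k) | snd-pair f (pair x k) | fst-pair x k | snd-pair x k = refl

  check-result : ℕ → ℕ → ℕ → ℕ → ℕ
  check-result t r K v =
    ifz (t ∸ 4) (ifz r (pair K v) (pair (cons (pair 13 (pair t r)) K) v)) (
    ifz (t ∸ 7) (pair (cons (pair 13 (fst r)) (cons (pair 13 (snd r)) K)) v) (
    ifz (t ∸ 8) (pair (cons (pair 13 r) K) v)
                (pair (cons (pair 13 (pair t r)) K) v)))

  step-check : ∀ t r K v → step o (pair (cons (pair 13 (pair t r)) K) v) ≡ check-result t r K v
  step-check t r K v = trans (step-cons 13 (pair t r) K v) lemma
    where
    lemma : act (o v) 13 (pair t r) K v ≡ check-result t r K v
    lemma rewrite fst-pair t r | snd-pair t r = refl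

  check-valid : ∀ e K v → pair (cons (pair 13 (encode e)) K) v ↠ pair K v
  check-valid e K v = subst (λ c → pair (cons (pair 13 c) K) v ↠ pair K v) (sym (encode≡pair e))
    (step-check (tag e) (body e) K v ◅ check-body e)
    where
    both : ∀ f g → check-result 5 (pair (encode f) (encode g)) K v ↠ pair K v
    both f g = subst₂ (λ a b → pair (cons (pair 13 a) (cons (pair 13 b) K)) v ↠ pair K v)
      (sym (fst-pair _ _)) (sym (snd-pair _ _)) (check-valid f _ v ◅◅ check-valid g K v)
    check-body : ∀ e → check-result (tag e) (body e) K v ↠ pair K v
    check-body zeroᶜ       = stop
    check-body succᶜ       = stop
    check-body leftᶜ       = stop
    check-body rightᶜ      = stop
    check-body oracleᶜ     = stop
    check-body (pairᶜ f g) = both f g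
    check-body (compᶜ f g) = both f g
    check-body (precᶜ f g) = both f g
    check-body (muᶜ f)     = check-valid f K v

  module _ {y : ℕ} where

    Ends : ℕ → ℕ → Set
    Ends n s = run o n s ≡ pair 0 y

    -- A run that ends cannot be over while the stack is non-empty. Each unfolding shortens the run,
    -- and its length is the measure for the converse arguments below.
    unstep : ∀ {n f K v s} → step o (pair (cons f K) v) ≡ s → Ends n (pair (cons f K) v) →
      ∃[ m ] m < n × Ends m s
    unstep {zero}  eq p with () ← proj₁ (pair-injective p)
    unstep {suc n} {f} {K} {v} eq p = n , ≤-refl ,
      trans (cong (run o n) (sym eq)) (trans (sym (run-suc n _)) p)

    -- Induction on the length of the run: the two checks for subprograms are stacked, and the
    -- second starts where the first one stopped.
    check-sound : ∀ n → Acc _<_ n → ∀ t r {K v} → Ends n (pair (cons (pair 13 (pair t r)) K) v) →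
      (∃[ e ] encode e ≡ pair t r) × (∃[ m ] m < n × Ends m (pair K v))
    check-sound n (acc rs) t r {K} {v} p with unstep (step-check t r K v) p
    ... | m , m<n , q = go t r m<n q
      where
      split : ∀ {m} c {K v} → m < n → Ends m (pair (cons (pair 13 c) K) v) →
        (∃[ e ] encode e ≡ c) × (∃[ l ] l < n × Ends l (pair K v))
      split {m} c m<n q with check-sound m (rs m<n) (fst c) (snd c)
        (subst (λ c → Ends m (pair (cons (pair 13 c) _) _)) (sym (pair-fst-snd c)) q)
      ... | (e , eq) , l , l<m , q′ = (e , trans eq (pair-fst-snd c)) , l , <-trans l<m m<n , q′
      both : ∀ {m} r → m < n → Ends m (pair (cons (pair 13 (fst r)) (cons (pair 13 (snd r)) K)) v) →
        ∃[ f ] ∃[ g ] pair (encode f) (encode g) ≡ r × (∃[ l ] l < n × Ends l (pair K v))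
      both r m<n q with split (fst r) m<n q
      ... | (f , p₁) , l , l<n , q′ with split (snd r) l<n q′
      ... | (g , p₂) , end = f , g , trans (cong₂ pair p₁ p₂) (pair-fst-snd r) , end
      -- The looping case: a shorter run from the same state also ends, so the induction hypothesis
      -- applies.
      again : ∀ {m t r} → m < n → Ends m (pair (cons (pair 13 (pair t r)) K) v) →
        (∃[ e ] encode e ≡ pair t r) × (∃[ l ] l < n × Ends l (pair K v))
      again {m} {t} {r} m<n q with check-sound m (rs m<n) t r q
      ... | ee , l , l<m , q′ = ee , l , <-trans l<m m<n , q′
      leaf : ∀ {m t} r e → tag e ≡ t → body e ≡ 0 → m < n →
        Ends m (ifz r (pair K v) (pair (cons (pair 13 (pair t r)) K) v)) →
        (∃[ e ] encode e ≡ pair t r) × (∃[ m ] m < n × Ends m (pair K v))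
      leaf {m} zero e t≡ b≡ m<n q = (e , trans (encode≡pair e) (cong₂ pair t≡ b≡)) , m , m<n , q
      leaf (suc r) e _ _ m<n q = again m<n q
      go : ∀ {m} t r → m < n → Ends m (check-result t r K v) →
        (∃[ e ] encode e ≡ pair t r) × (∃[ m ] m < n × Ends m (pair K v))
      go 0 r = leaf r zeroᶜ refl refl
      go 1 r = leaf r succᶜ refl refl
      go 2 r = leaf r leftᶜ refl refl
      go 3 r = leaf r rightᶜ refl refl
      go 4 r = leaf r oracleᶜ refl refl
      go 5 r m<n q with both r m<n q
      ... | f , g , eq , end = (pairᶜ f g , trans (encode≡pair (pairᶜ f g)) (cong (pair 5) eq)) , end
      go 6 r m<n q with both r m<n q
      ... | f , g , eq , end = (compᶜ f g , trans (encode≡pair (compᶜ f g)) (cong (pair 6) eq)) , end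
      go 7 r m<n q with both r m<n q
      ... | f , g , eq , end = (precᶜ f g , trans (encode≡pair (precᶜ f g)) (cong (pair 7) eq)) , end
      go 8 r m<n q with split r m<n q
      ... | (f , eq) , end = (muᶜ f , trans (encode≡pair (muᶜ f)) (cong (pair 8) eq)) , end
      go (suc (suc (suc (suc (suc (suc (suc (suc (suc t))))))))) r m<n q = again m<n q

program : Code → ℕ → ℕ
program e x = pair (cons (encode e) 0) x

-- Members of `jump` are numbers of programs, so `c` is validated before it is run on itself.
self : ℕ → ℕ
self c = pair (cons (pair 13 c) (cons c 0)) c

module Simulation {O : Pred ℕ 0ℓ} {o : ℕ → ℕ}
  (o-spec : ∀ x → (O x × o x ≡ 1) ⊎ (¬ O x × o x ≡ 0)) where

  open Steps o

  -- The rest `K` of the stack is arbitrary, so that the runs of subprograms can be concatenated.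
  simulates : ∀ e {x y} K → Eval O e x y → pair (cons (encode e) K) x ↠ pair K y
  simulates zeroᶜ   K refl = step-code zeroᶜ K _ ◅ stop
  simulates succᶜ   K refl = step-code succᶜ K _ ◅ stop
  simulates leftᶜ   {x} K p with refl ← to (eval-left {O} {x}) p = step-code leftᶜ K _ ◅ stop
  simulates rightᶜ  {x} K p with refl ← to (eval-right {O} {x}) p = step-code rightᶜ K _ ◅ stop
  simulates oracleᶜ {x} K p with refl ← Eval-functional {O} oracleᶜ p (o-spec x) = step-code oracleᶜ K _ ◅ stop
  simulates (pairᶜ f g) {x} K p with to (eval-pair f g {x}) p
  ... | u , v , pf , pg , refl =
    step-pair f g K _ ◅ simulates f _ pf ◅◅ step-pair₁ _ _ K u ◅ simulates g _ pg ◅◅ step-pair₂ u K v ◅ stop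
  simulates (compᶜ f g) K (u , pg , pf) = step-comp f g K _ ◅ simulates g _ pg ◅◅ simulates f K pf
  simulates (precᶜ g h) {x} K p = loop (snd x) K refl p
    where
    loop : ∀ n {x y} K → snd x ≡ n → Eval O (precᶜ g h) x y → pair (cons (encode (precᶜ g h)) K) x ↠ pair K y
    loop zero    {x} K eq p = step-prec-zero g h K _ eq ◅ simulates g K (to (eval-prec-zero g h {x} eq) p)
    loop (suc n) {x} K eq p with to (eval-prec-suc g h {x} eq) p
    ... | r , pr , ph = step-prec-suc g h K x n eq ◅ loop n _ (snd-pair (fst x) n) pr
                        ◅◅ step-prec (encode h) (fst x) n K r ◅ simulates h K ph
  simulates (muᶜ f) {x} {y} K p with to (eval-mu f {x}) p
  ... | p₀ , p₊ = step-mu f K x ◅ loop y 0 (+-identityʳ y)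
    where
    loop : ∀ d k → d + k ≡ y →
      pair (cons (encode f) (cons (pair 12 (pair (encode f) (pair x k))) K)) (pair x k) ↠ pair K y
    loop zero    k refl = simulates f _ p₀ ◅◅ step-mu-zero (encode f) x k K ◅ stop
    loop (suc d) k eq with p₊ k (≤-trans (s≤s (m≤n+m k d)) (≤-reflexive eq))
    ... | v , pv = simulates f _ pv ◅◅ step-mu-suc (encode f) x k K v ◅ loop d (suc k) (trans (+-suc d k) eq)

  module _ {y : ℕ} where

    Returns : ℕ → Code → ℕ → ℕ → Set
    Returns n e x K = ∃[ u ] ∃[ m ] m < n × Eval O e x u × Ends {y} m (pair K u)

    below-suc : ∀ {P : ℕ → ℕ → Set} {k v} → P k (suc v) → (∀ i → i < k → ∃[ w ] P i (suc w)) →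
      ∀ i → i < suc k → ∃[ w ] P i (suc w)
    below-suc pk below i (s≤s i≤k) with m≤n⇒m<n∨m≡n i≤k
    ... | inj₁ i<k  = below i i<k
    ... | inj₂ refl = _ , pk

    mutual
      -- A run that empties the stack has to pop the top frame, and until then it traces an
      -- evaluation. The induction is on its length because a `muᶜ` search has no bound in the
      -- program.
      reflects : ∀ n → Acc _<_ n → ∀ e {x K} → Ends {y} n (pair (cons (encode e) K) x) → Returns n e x K
      reflects n a zeroᶜ p with unstep (step-code zeroᶜ _ _) p
      ... | m , m<n , q = _ , m , m<n , refl , q
      reflects n a succᶜ p with unstep (step-code succᶜ _ _) p
      ... | m , m<n , q = _ , m , m<n , refl , q
      reflects n a leftᶜ {x} p with unstep (step-code leftᶜ _ _) p
      ... | m , m<n , q = _ , m , m<n , from (eval-left {O} {x}) refl , q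
      reflects n a rightᶜ {x} p with unstep (step-code rightᶜ _ _) p
      ... | m , m<n , q = _ , m , m<n , from (eval-right {O} {x}) refl , q
      reflects n a oracleᶜ {x} p with unstep (step-code oracleᶜ _ _) p
      ... | m , m<n , q = _ , m , m<n , o-spec x , q
      reflects n (acc rs) (pairᶜ f g) {x} p
        with m₁ , l₁ , q₁ ← unstep (step-pair f g _ _) p
        with u , m₂ , l₂ , pf , q₂ ← reflects m₁ (rs l₁) f q₁
        with m₃ , l₃ , q₃ ← unstep (step-pair₁ (encode g) _ _ u) q₂
        with v , m₄ , l₄ , pg , q₄ ← reflects m₃ (rs (<-trans l₃ (<-trans l₂ l₁))) g q₃
        with m₅ , l₅ , q₅ ← unstep (step-pair₂ u _ v) q₄ =
        pair u v , m₅ , <-trans l₅ (<-trans l₄ (<-trans l₃ (<-trans l₂ l₁))) ,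
        from (eval-pair f g {x}) (u , v , pf , pg , refl) , q₅
      reflects n (acc rs) (compᶜ f g) p
        with m₁ , l₁ , q₁ ← unstep (step-comp f g _ _) p
        with u , m₂ , l₂ , pg , q₂ ← reflects m₁ (rs l₁) g q₁
        with v , m₃ , l₃ , pf , q₃ ← reflects m₂ (rs (<-trans l₂ l₁)) f q₂ =
        v , m₃ , <-trans l₃ (<-trans l₂ l₁) , (u , pg , pf) , q₃
      reflects n a (precᶜ g h) {x} p = reflects-prec n a g h (snd x) refl p
      reflects n (acc rs) (muᶜ f) {x} p
        with m₁ , l₁ , q₁ ← unstep (step-mu f _ x) p
        with v , m₂ , l₂ , pf , q₂ ← reflects m₁ (rs l₁) f q₁
        with u , m₃ , l₃ , pu , q₃ ← reflects-mu m₂ (rs (<-trans l₂ l₁)) f v 0 pf (λ _ ()) q₂ =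
        u , m₃ , <-trans l₃ (<-trans l₂ l₁) , pu , q₃

      reflects-prec : ∀ n → Acc _<_ n → ∀ g h k {x K} → snd x ≡ k →
        Ends {y} n (pair (cons (encode (precᶜ g h)) K) x) → Returns n (precᶜ g h) x K
      reflects-prec n (acc rs) g h zero {x} eq p
        with m₁ , l₁ , q₁ ← unstep (step-prec-zero g h _ _ eq) p
        with u , m₂ , l₂ , pg , q₂ ← reflects m₁ (rs l₁) g q₁ =
        u , m₂ , <-trans l₂ l₁ , from (eval-prec-zero g h {x} eq) pg , q₂
      reflects-prec n (acc rs) g h (suc k) {x} eq p
        with m₁ , l₁ , q₁ ← unstep (step-prec-suc g h _ _ k eq) p
        with r , m₂ , l₂ , pr , q₂ ← reflects-prec m₁ (rs l₁) g h k (snd-pair (fst x) k) q₁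
        with m₃ , l₃ , q₃ ← unstep (step-prec (encode h) (fst x) k _ r) q₂
        with u , m₄ , l₄ , ph , q₄ ← reflects m₃ (rs (<-trans l₃ (<-trans l₂ l₁))) h q₃ =
        u , m₄ , <-trans l₄ (<-trans l₃ (<-trans l₂ l₁)) , from (eval-prec-suc g h {x} eq) (r , pr , ph) , q₄

      -- Loop invariant of the search: all candidates below `k` gave positive values, and `v` is the
      -- value at `k`, not yet tested.
      reflects-mu : ∀ n → Acc _<_ n → ∀ f v k {x K} → Eval O f (pair x k) v →
        (∀ i → i < k → ∃[ w ] Eval O f (pair x i) (suc w)) →
        Ends {y} n (pair (cons (pair 12 (pair (encode f) (pair x k))) K) v) → Returns n (muᶜ f) x K
      reflects-mu n (acc rs) f zero k {x} pf below p
        with m₁ , l₁ , q₁ ← unstep (step-mu-zero (encode f) _ k _) p =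
        k , m₁ , l₁ , from (eval-mu f {x}) (pf , below) , q₁
      reflects-mu n (acc rs) f (suc v) k {x} pf below p
        with m₁ , l₁ , q₁ ← unstep (step-mu-suc (encode f) _ k _ v) p
        with w , m₂ , l₂ , pw , q₂ ← reflects m₁ (rs l₁) f q₁
        with u , m₃ , l₃ , pu , q₃ ← reflects-mu m₂ (rs (<-trans l₂ l₁)) f w (suc k) pw
          (below-suc {λ i → Eval O f (pair x i)} pf below) q₂ =
        u , m₃ , <-trans l₃ (<-trans l₂ l₁) , pu , q₃

  eval⇔run : ∀ e x y → Eval O e x y ⇔ (∃[ n ] run o n (program e x) ≡ pair 0 y)
  eval⇔run e x y = mk⇔ (simulates e 0) λ (n , p) → back n p
    where
    back : ∀ n → run o n (program e x) ≡ pair 0 y → Eval O e x y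
    back n p with u , m , _ , pe , q ← reflects n (<-wellFounded n) e p =
      subst (Eval O e x) (proj₂ (pair-injective (trans (sym (halted m)) q))) pe
      where
      halted : ∀ m {u} → run o m (pair 0 u) ≡ pair 0 u
      halted zero    = refl
      halted (suc m) = trans (cong (step o) (halted m)) (halted-step (fst-pair 0 _))

  jump⇔run : ∀ c → jump O c ⇔ (∃[ n ] fst (run o n (self c)) ≡ 0)
  jump⇔run c = mk⇔
    (λ { (e , refl , y , p) →
      let n , q = check-valid e (cons (encode e) 0) (encode e) ◅◅ simulates e 0 p
      in n , trans (cong fst q) (fst-pair 0 y) })
    λ (n , p) → back n (trans (sym (pair-fst-snd _)) (cong (λ K → pair K (snd (run o n (self c)))) p))
    where
    back : ∀ n {y} → run o n (self c) ≡ pair 0 y → jump O c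
    back n p
      with (e , e≡) , m , _ , q ← check-sound n (<-wellFounded n) (fst c) (snd c)
        (subst (λ d → Ends n (pair (cons (pair 13 d) (cons c 0)) c)) (sym (pair-fst-snd c)) p)
      with refl ← trans e≡ (pair-fst-snd c)
      with u , _ , _ , pe , _ ← reflects m (<-wellFounded m) e q = e , refl , u , pe

-- Programs with a jump as oracle

module Limits (em : ExcludedMiddle 0ℓ) where
  open Classical em

  stage : Pred ℕ 0ℓ → ℕ → ℕ → ℕ
  stage O t q = ifz (fst (run (χ O) t (self q))) 1 0

  stage-computable : ∀ {O} → Computable₂ O (stage O)
  stage-computable = curried (ifz-computable
    (fst-computable ⊙ run-computable {o = λ _ → χ _} (curried (χ-computable ⊙ snd-computable)) fst-computable
      (pair-computable
        (suc-computable ⊙ pair-computable (pair-computable (const-computable 13) snd-computable)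
          (suc-computable ⊙ pair-computable snd-computable (const-computable 0)))
        snd-computable))
    (const-computable 1) (const-computable 0))

  -- The approximation changes at most once, from 0 to 1, because a halted machine stays halted.
  stage-limit : ∀ O q → ∃[ s ] ∀ t → stage O (t + s) q ≡ χ (jump O) q
  stage-limit O q with χ-spec (jump O) q
  ... | inj₁ (j , χ≡1) = let n , halted = to (jump⇔run q) j in n , λ t →
    trans (cong (λ k → ifz k 1 0) (trans (cong fst (run-halted t n halted)) halted)) (sym χ≡1)
    where
    open Simulation (χ-spec O)
    open Steps (χ O)
  ... | inj₂ (nj , χ≡0) = 0 , λ t →
    trans (running _ (λ halted → nj (from (jump⇔run q) (t + 0 , halted)))) (sym χ≡0)
    where
    open Simulation (χ-spec O)
    running : ∀ k → ¬ k ≡ 0 → ifz k 1 0 ≡ 0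
    running zero    nz = ⊥-elim (nz refl)
    running (suc k) nz = refl

  -- A finite computation asks finitely many questions, hence all late
  -- approximations to the oracle agree on it.
  run-limit : ∀ {o : ℕ → ℕ} {a : ℕ → ℕ → ℕ} → (∀ q → ∃[ s ] ∀ t → a (t + s) q ≡ o q) →
    ∀ n x → ∃[ s ] ∀ t → run (a (t + s)) n x ≡ run o n x
  run-limit lim zero    x = 0 , λ _ → refl
  run-limit {o} {a} lim (suc n) x
    with s₁ , agree ← run-limit {o} {a} lim n x | s₂ , answer ← lim (snd (run o n x)) =
    s₁ + s₂ , λ t → trans
      (cong (step (a (t + (s₁ + s₂)))) (trans (cong (λ s → run (a s) n x) (first t)) (agree (t + s₂))))
      (step-cong {a (t + (s₁ + s₂))} {o} (run o n x)
        (trans (cong (λ s → a s (snd (run o n x))) (second t)) (answer (t + s₁))))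
    where
    first : ∀ t → t + (s₁ + s₂) ≡ (t + s₂) + s₁
    first t = trans (cong (t +_) (+-comm s₁ s₂)) (sym (+-assoc t s₂ s₁))
    second : ∀ t → t + (s₁ + s₂) ≡ (t + s₁) + s₂
    second t = sym (+-assoc t s₁ s₂)
    step-cong : ∀ {f g : ℕ → ℕ} s → f (snd s) ≡ g (snd s) → step f s ≡ step g s
    step-cong s eq rewrite eq = refl

  opaque
    LateRun : Pred ℕ 0ℓ → Code → ℕ → ℕ → ℕ → ℕ → Set
    LateRun O c x y p t = run (stage O (t + fst p)) (snd p) (program c x) ≡ pair 0 y

    -- The Σ₂ form of evaluation relative to a jump: `p` packs a stage from which the oracle answers
    -- have settled and the length of the run.
    eval-jump : ∀ O c x y → Eval (jump O) c x y ⇔ (∃[ p ] ∀ t → LateRun O c x y p t)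
    eval-jump O c x y = mk⇔
      (λ e → let n , r = to (eval⇔run c x y) e
                 s , agree = run-limit {a = stage O} (stage-limit O) n (program c x)
             in pair s n , λ t → trans
               (cong₂ (λ s n → run (stage O (t + s)) n (program c x)) (fst-pair s n) (snd-pair s n))
               (trans (agree t) r))
      -- The stage in `p` may be too early, so `late` is used at `s`, where the approximation is
      -- correct for this run.
      (λ (p , late) → let s , agree = run-limit {a = stage O} (stage-limit O) (snd p) (program c x) in
        from (eval⇔run c x y) (snd p , trans
          (trans (sym (agree (fst p))) (cong (λ t → run (stage O t) (snd p) (program c x)) (+-comm (fst p) s)))
          (late s)))
      where open Simulation (χ-spec (jump O))

    lateRunʳ : ∀ {O c X Y P T} → Computable O X → Computable O Y → Computable O P → Computable O T →
      Recursive O (λ z → LateRun O c (X z) (Y z) (P z) (T z))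
    lateRunʳ {O} {c} {P = P} {T} x y p t = ≡ʳ
      (run-computable {o = λ z → stage O (T z + fst (P z))} (curried (ap₂ stage-computable
          (ap₂ +-computable (t ⊙ fst-computable) (fst-computable ⊙ p ⊙ fst-computable)) snd-computable))
        (snd-computable ⊙ p)
        (pair-computable (const-computable (cons (encode c) 0)) x))
      (pair-computable (const-computable 0) y)

  eval-zero : ∀ {O P} → Recursive O P → ∃[ c ] ∀ x → P x ⇔ Eval O c x 0
  eval-zero {O} (recursive F (computes c evaluates) correct) = c , λ x → mk⇔
    (λ p → subst (Eval O c x) (to (correct x) p) (evaluates x))
    (λ ev → from (correct x) (Eval-functional c (evaluates x) ev))

  LateRunAt : Pred ℕ 0ℓ → Code → ℕ → ℕ → Set
  LateRunAt O e w t = LateRun O e (fst (fst w)) (snd (fst w)) (snd w) t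

  lateRunAtʳ : ∀ {O} e → Recursive O (λ z → LateRunAt O e (fst z) (snd z))
  lateRunAtʳ e = lateRunʳ
    (fst-computable ⊙ fst-computable ⊙ fst-computable) (snd-computable ⊙ fst-computable ⊙ fst-computable)
    (snd-computable ⊙ fst-computable) snd-computable

  module _ O (Q : ℕ → ℕ → Set) c (¬Q⇔eval : ∀ z → (¬ Q (fst z) (snd z)) ⇔ Eval (jump O) c z 0) where

    -- Negating the Σ₂ form of `¬ Q` yields a Π₂ form of `Q`. Here `t` packs the argument of `Q` and
    -- a candidate witness against it, and `r` is a stage at which the candidate fails.
    Refutes : ℕ → ℕ → ℕ → Set
    Refutes w t r = ¬ LateRun O c (pair w (fst t)) 0 (snd t) r

    refutesʳ : Recursive O (λ z → Refutes (fst (fst z)) (snd (fst z)) (snd z))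
    refutesʳ = ¬ʳ lateRunʳ
      (pair-computable (fst-computable ⊙ fst-computable) (fst-computable ⊙ snd-computable ⊙ fst-computable))
      (const-computable 0) (snd-computable ⊙ snd-computable ⊙ fst-computable) snd-computable

    refute : ∀ w t → Q w (fst t) → ∃[ r ] Refutes w t r
    refute w t q with em {∃[ r ] Refutes w t r}
    ... | yes found = found
    ... | no none = ⊥-elim (from (¬Q⇔eval (pair w (fst t))) (from (eval-jump O c _ _) (snd t , late))
                      (subst₂ Q (sym (fst-pair w (fst t))) (sym (snd-pair w (fst t))) q))
      where
      late : ∀ r → LateRun O c (pair w (fst t)) 0 (snd t) r
      late r with em {LateRun O c (pair w (fst t)) 0 (snd t) r}
      ... | yes l = l
      ... | no nl = ⊥-elim (none (r , nl))

    confirm : ∀ w t → (∀ q → ∃[ r ] Refutes w (pair t q) r) → Q w t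
    confirm w t all with em {Q w t}
    ... | yes q = q
    ... | no nq
      with q , late ← to (eval-jump O c _ _)
        (to (¬Q⇔eval (pair w t)) (nq ∘ subst₂ Q (fst-pair w t) (snd-pair w t)))
      with r , x ← all q = ⊥-elim (x
        (subst₂ (λ t q → LateRun O c (pair w t) 0 q r) (sym (fst-pair t q)) (sym (snd-pair t q)) (late r)))

  -- `eval-jump` over `jump O` gives the prefix ∃∀ with a matrix recursive in `jump O`; its Π₂ form
  -- over `O` contributes ∀∃. The two adjacent universal quantifiers share one `t`.
  Σ₃-form : ∀ O e → ∃[ E ] Recursive O (λ z → E (fst (fst z)) (snd (fst z)) (snd z)) ×
    (∀ m → Eval (jump (jump O)) e (fst m) (snd m) ⇔ (∃[ p ] ∀ t → ∃[ r ] E (pair m p) t r))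
  Σ₃-form O e with c , ¬Q⇔eval ← eval-zero (¬ʳ lateRunAtʳ {jump O} e) =
    Refutes O (LateRunAt (jump O) e) c ¬Q⇔eval , refutesʳ O (LateRunAt (jump O) e) c ¬Q⇔eval , λ m → mk⇔
    (λ ev → let p , late = to (eval-jump (jump O) e (fst m) (snd m)) ev in
      p , λ t → refute O (LateRunAt (jump O) e) c ¬Q⇔eval (pair m p) t
        (subst₂ (λ m p → LateRun (jump O) e (fst m) (snd m) p (fst t))
          (sym (fst-pair m p)) (sym (snd-pair m p)) (late (fst t))))
    (λ (p , all) → from (eval-jump (jump O) e (fst m) (snd m))
      (p , λ t → subst₂ (λ m p → LateRun (jump O) e (fst m) (snd m) p t) (fst-pair m p) (snd-pair m p)
        (confirm O (LateRunAt (jump O) e) c ¬Q⇔eval (pair m p) t λ q → all (pair t q))))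

-- The fence

-- A number a stands for the positive rational (fst a + 1) / (snd a + 1).

infix 4 _<ℚ_
_<ℚ_ : ℕ → ℕ → Set
a <ℚ b = suc (fst a) * suc (snd b) < suc (fst b) * suc (snd a)

_≤ℚ_ : ℕ → ℕ → Set
a ≤ℚ b = suc (fst a) * suc (snd b) ≤ suc (fst b) * suc (snd a)

≤ℚ-<ℚ-trans : ∀ {a b c} → a ≤ℚ b → b <ℚ c → a <ℚ c
≤ℚ-<ℚ-trans {a} {b} {c} =
  cross (suc (fst a)) (suc (snd a)) (suc (fst b)) (suc (snd b)) (suc (fst c)) (suc (snd c))
  where
  swap : ∀ x y z → x * y * z ≡ x * z * y
  swap x y z = trans (*-assoc x y z) (trans (cong (x *_) (*-comm y z)) (sym (*-assoc x z y)))
  cross : ∀ x y u v s t → .{{NonZero t}} → .{{NonZero y}} → .{{NonZero v}} →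
    x * v ≤ u * y → u * t < s * v → x * t < s * y
  cross x y u v s t p q = *-cancelʳ-< v (x * t) (s * y) (begin-strict
    x * t * v ≡⟨ swap x t v ⟩
    x * v * t ≤⟨ *-monoˡ-≤ t p ⟩
    u * y * t ≡⟨ swap u y t ⟩
    u * t * y <⟨ *-monoˡ-< y q ⟩
    s * v * y ≡⟨ swap s v y ⟩
    s * y * v ∎)
    where open ≤-Reasoning

<ℚ-trans : ∀ {a b c} → a <ℚ b → b <ℚ c → a <ℚ c
<ℚ-trans {a} {b} {c} p q = ≤ℚ-<ℚ-trans {a} {b} {c} (<⇒≤ p) q

-- Sum of numerators over sum of denominators; the code stores each of them diminished by one.
mediant : ℕ → ℕ → ℕ
mediant a b = pair (fst a + suc (fst b)) (snd a + suc (snd b))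

<ℚ-mediant : ∀ {a b} → a <ℚ b → a <ℚ mediant a b
<ℚ-mediant {a} {b} p
  rewrite fst-pair (fst a + suc (fst b)) (snd a + suc (snd b))
        | snd-pair (fst a + suc (fst b)) (snd a + suc (snd b)) = begin-strict
  x * (y + v)    ≡⟨ *-distribˡ-+ x y v ⟩
  x * y + x * v  <⟨ +-monoʳ-< (x * y) p ⟩
  x * y + u * y  ≡⟨ *-distribʳ-+ y x u ⟨
  (x + u) * y    ∎
  where
  open ≤-Reasoning
  x = suc (fst a)
  y = suc (snd a)
  u = suc (fst b)
  v = suc (snd b)

mediant-<ℚ : ∀ {a b} → a <ℚ b → mediant a b <ℚ b
mediant-<ℚ {a} {b} p
  rewrite fst-pair (fst a + suc (fst b)) (snd a + suc (snd b))
        | snd-pair (fst a + suc (fst b)) (snd a + suc (snd b)) = begin-strict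
  (x + u) * v    ≡⟨ *-distribʳ-+ v x u ⟩
  x * v + u * v  <⟨ +-monoˡ-< (u * v) p ⟩
  u * y + u * v  ≡⟨ *-distribˡ-+ u y v ⟨
  u * (y + v)    ∎
  where
  open ≤-Reasoning
  x = suc (fst a)
  y = suc (snd a)
  u = suc (fst b)
  v = suc (snd b)

smaller : ∀ b → ∃[ a ] a <ℚ b
smaller b = pair (fst b) (suc (snd b)) , lemma
  where
  lemma : pair (fst b) (suc (snd b)) <ℚ b
  lemma rewrite fst-pair (fst b) (suc (snd b)) | snd-pair (fst b) (suc (snd b)) =
    *-monoʳ-< (suc (fst b)) ≤-refl

-- `pair k 0` is the integer k + 1, here larger than the numerator of `a` and so than `a`. The slack
-- `n` lets it pass a given height as well.
<ℚ-natural : ∀ a n → a <ℚ pair (suc (fst a) + n) 0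
<ℚ-natural a n rewrite fst-pair (suc (fst a) + n) 0 | snd-pair (suc (fst a) + n) 0 = begin-strict
  x * 1          ≡⟨ *-identityʳ x ⟩
  x              <⟨ ≤-refl ⟩
  suc x          ≤⟨ m≤m+n (suc x) n ⟩
  suc x + n      ≤⟨ m≤m*n (suc x + n) (suc (snd a)) ⟩
  (suc x + n) * suc (snd a) ∎
  where
  open ≤-Reasoning
  x = suc (fst a)

natural-<ℚ : ∀ {m n} → pair m 0 <ℚ pair n 0 → m < n
natural-<ℚ {m} {n} p
  rewrite fst-pair m 0 | snd-pair m 0 | fst-pair n 0 | snd-pair n 0 | *-identityʳ m | *-identityʳ n = ≤-pred p

-- Two rationals may lie below a top by virtue of different thresholds `c` and `d`. It suffices to
-- move from the larger one towards its own threshold.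
<ℚ-upper-bound : ∀ {a b c d} → a <ℚ c → b <ℚ d → ∃[ u ] a <ℚ u × b <ℚ u × (u <ℚ c ⊎ u <ℚ d)
<ℚ-upper-bound {a} {b} {c} {d} p q with ≤-total (suc (fst a) * suc (snd b)) (suc (fst b) * suc (snd a))
... | inj₁ a≤b = mediant b d ,
  ≤ℚ-<ℚ-trans {a} {b} {mediant b d} a≤b (<ℚ-mediant {b} {d} q) ,
  <ℚ-mediant {b} {d} q , inj₂ (mediant-<ℚ {b} {d} q)
... | inj₂ b≤a = mediant a c , <ℚ-mediant {a} {c} p ,
  ≤ℚ-<ℚ-trans {b} {a} {mediant a c} b≤a (<ℚ-mediant {a} {c} p) , inj₁ (mediant-<ℚ {a} {c} p)

<ℚ-bounded : ∀ {a b c} → a <ℚ c → b <ℚ c → ∃[ u ] a <ℚ u × b <ℚ u × u <ℚ c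
<ℚ-bounded {a} {b} {c} p q with <ℚ-upper-bound {a} {b} {c} {c} p q
... | u , au , bu , inj₁ uc = u , au , bu , uc
... | u , au , bu , inj₂ uc = u , au , bu , uc

-- The number ⟨ k , ⟨ m , a ⟩ ⟩ is the rational a on the m-th branch (k = 1) or
-- on a chain linking the branches m and m + 1 (k ≥ 2), or it is a top of the
-- m-th branch (k = 0).  H m a t says that the height of the top is at least t,
-- in which case it lies above the rationals below t + 1.

data Edge (H : ℕ → ℕ → ℕ → Set) : (k m a k′ m′ a′ : ℕ) → Set where
  along : ∀ {k m a b} → a <ℚ b → Edge H (suc k) m a (suc k) m b
  left  : ∀ {k l m a b} → l ≤ 1 → Edge H (2 + k) m a l m b
  right : ∀ {k l m a b} → l ≤ 1 → Edge H (2 + k) m a l (suc m) b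
  reach : ∀ {m a b t} → a <ℚ pair t 0 → H m b t → Edge H 1 m a 0 m b

element : ℕ → ℕ → ℕ → ℕ
element k m a = pair k (pair m a)

kind branch position : ℕ → ℕ
kind     x = fst x
branch   x = fst (snd x)
position x = snd (snd x)

kind-element : ∀ k m a → kind (element k m a) ≡ k
kind-element k m a = fst-pair k (pair m a)

branch-element : ∀ k m a → branch (element k m a) ≡ m
branch-element k m a = trans (cong fst (snd-pair k (pair m a))) (fst-pair m a)

position-element : ∀ k m a → position (element k m a) ≡ a
position-element k m a = trans (cong snd (snd-pair k (pair m a))) (snd-pair m a)

element-η : ∀ x → element (kind x) (branch x) (position x) ≡ x
element-η x = trans (cong (pair (fst x)) (pair-fst-snd (snd x))) (pair-fst-snd x)

Fence : (ℕ → ℕ → ℕ → Set) → Rel ℕ 0ℓ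
Fence H x y = Edge H (kind x) (branch x) (position x) (kind y) (branch y) (position y)

module _ {H : ℕ → ℕ → ℕ → Set} where

  Edge-trans : ∀ {k m a k′ m′ a′ k″ m″ a″} →
    Edge H k m a k′ m′ a′ → Edge H k′ m′ a′ k″ m″ a″ → Edge H k m a k″ m″ a″
  Edge-trans (along {a = a} {b} p) (along {b = c} q) = along (<ℚ-trans {a} {b} {c} p q)
  Edge-trans (along p) (left q)    = left q
  Edge-trans (along p) (right q)   = right q
  Edge-trans (along {a = a} {b} p) (reach {t = t} q h) = reach (<ℚ-trans {a} {b} {pair t 0} p q) h
  Edge-trans (left p)  (along q)   = left p
  Edge-trans (left p)  (reach q h) = left z≤n
  Edge-trans (right p) (along q)   = right p
  Edge-trans (right p) (reach q h) = right z≤n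
  Edge-trans (left (s≤s ())) (left _)
  Edge-trans (left (s≤s ())) (right _)
  Edge-trans (right (s≤s ())) (left _)
  Edge-trans (right (s≤s ())) (right _)

  Edge-irrefl : ∀ {k m a} → ¬ Edge H k m a k m a
  Edge-irrefl (along p) = <-irrefl refl p
  Edge-irrefl (left (s≤s ()))

  packˡ : ∀ {k m a y} → Edge H k m a (kind y) (branch y) (position y) → Fence H (element k m a) y
  packˡ {k} {m} {a} e rewrite kind-element k m a | branch-element k m a | position-element k m a = e

  packʳ : ∀ {x k m a} → Edge H (kind x) (branch x) (position x) k m a → Fence H x (element k m a)
  packʳ {_} {k} {m} {a} e rewrite kind-element k m a | branch-element k m a | position-element k m a = e

  Fence-element : ∀ k m a k′ m′ a′ → Fence H (element k m a) (element k′ m′ a′) ≡ Edge H k m a k′ m′ a′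
  Fence-element k m a k′ m′ a′
    rewrite kind-element k m a | branch-element k m a | position-element k m a
          | kind-element k′ m′ a′ | branch-element k′ m′ a′ | position-element k′ m′ a′ = refl

  module _ (H₀ : ∀ m a → H m a 0) where

    Edge-below : ∀ k m a → k ≤ 1 → ∃[ b ] Edge H 1 m b k m a
    Edge-below zero    m a _         = let b , p = smaller (pair 0 0) in b , reach p (H₀ m a)
    Edge-below (suc _) m a (s≤s z≤n) = let b , p = smaller a in b , along p

    -- Everything below a rational or top of a branch passes through a rational of that branch, even
    -- when it comes from a chain. Directedness thereby reduces to two rationals on one line.
    Edge-interpolates : ∀ {k m a k′ m′ a′} → Edge H k m a k′ m′ a′ → k′ ≤ 1 →
      ∃[ b ] Edge H k m a 1 m′ b × Edge H 1 m′ b k′ m′ a′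
    Edge-interpolates (along {a = a} {b} p) (s≤s z≤n) =
      mediant a b , along (<ℚ-mediant {a} {b} p) , along (mediant-<ℚ {a} {b} p)
    Edge-interpolates (reach {a = a} {t = t} p h) _ =
      mediant a (pair t 0) , along (<ℚ-mediant {a} {pair t 0} p) , reach (mediant-<ℚ {a} {pair t 0} p) h
    Edge-interpolates (left p)  l≤1 = let b , e = Edge-below _ _ _ l≤1 in b , left ≤-refl , e
    Edge-interpolates (right p) l≤1 = let b , e = Edge-below _ _ _ l≤1 in b , right ≤-refl , e

    Edge-chain-bounded : ∀ {m a b l c} → Edge H 1 m a l m c → Edge H 1 m b l m c →
      ∃[ u ] Edge H 1 m a 1 m u × Edge H 1 m b 1 m u × Edge H 1 m u l m c
    Edge-chain-bounded (along {a = a} {c} p) (along {a = b} q) =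
      let u , au , bu , uc = <ℚ-bounded {a} {b} {c} p q in u , along au , along bu , along uc
    Edge-chain-bounded (reach {a = a} {t = s} p h) (reach {a = b} {t = t} q i)
      with <ℚ-upper-bound {a} {b} {pair s 0} {pair t 0} p q
    ... | u , au , bu , inj₁ uc = u , along au , along bu , reach uc h
    ... | u , au , bu , inj₂ uc = u , along au , along bu , reach uc i

    Edge-bounded-branch : ∀ {k m a l n b l′ n′ b′} → Edge H l n b k m a → Edge H l′ n′ b′ k m a → k ≤ 1 →
      ∃[ u ] ∃[ w ] Edge H u m w k m a × Edge H l n b u m w × Edge H l′ n′ b′ u m w
    Edge-bounded-branch e e′ k≤1 =
      let b , f , g = Edge-interpolates e k≤1
          c , f′ , g′ = Edge-interpolates e′ k≤1
          u , bu , cu , uy = Edge-chain-bounded g g′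
      in 1 , u , uy , Edge-trans f bu , Edge-trans f′ cu

    Edge-predecessor : ∀ k m a → ∃[ l ] ∃[ b ] Edge H l m b k m a
    Edge-predecessor zero    m a = let b , e = Edge-below 0 m a z≤n in 1 , b , e
    Edge-predecessor (suc k) m a = let b , p = smaller a in suc k , b , along p

    Edge-bounded : ∀ k {m a l n b l′ n′ b′} → Edge H l n b k m a → Edge H l′ n′ b′ k m a →
      ∃[ u ] ∃[ w ] Edge H u m w k m a × Edge H l n b u m w × Edge H l′ n′ b′ u m w
    Edge-bounded (suc (suc k)) (along {a = a} {c} p) (along {a = b} q) =
      let w , aw , bw , wc = <ℚ-bounded {a} {b} {c} p q in suc (suc k) , w , along wc , along aw , along bw
    Edge-bounded (suc (suc k)) (left (s≤s ())) _
    Edge-bounded (suc (suc k)) (right (s≤s ())) _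
    Edge-bounded (suc (suc k)) (along _) (left (s≤s ()))
    Edge-bounded (suc (suc k)) (along _) (right (s≤s ()))
    Edge-bounded 0 e e′ = Edge-bounded-branch e e′ z≤n
    Edge-bounded 1 e e′ = Edge-bounded-branch e e′ ≤-refl

  Fence-irreflexive : Irreflexive _≡_ (Fence H)
  Fence-irreflexive refl = Edge-irrefl

  Fence-interpolable : (∀ m a → H m a 0) → Interpolable (Fence H)
  Fence-interpolable H₀ = Edge-trans , λ y →
    (let l , b , e = Edge-predecessor H₀ (kind y) (branch y) (position y) in _ , packˡ {y = y} e) ,
    λ x x′ p q → let u , w , e , f , g = Edge-bounded H₀ (kind y) p q in
      element u (branch y) w , packˡ {y = y} e , packʳ {x} f , packʳ {x′} g

-- Isomorphism of fences

indicator : ∀ {P : Set} → Dec P → ℕ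
indicator (yes _) = 1
indicator (no _)  = 0

count : (ℕ → ℕ) → ℕ → ℕ → ℕ
count c k zero    = 0
count c k (suc n) = indicator (c n ≟ k) + count c k n

count-mono : ∀ c k {m n} → m ≤ n → count c k m ≤ count c k n
count-mono c k {m} {n} m≤n with m≤n⇒m<n∨m≡n m≤n
... | inj₂ refl = ≤-refl
count-mono c k {m} {suc n} _ | inj₁ (s≤s m≤n) = ≤-trans (count-mono c k m≤n) (m≤n+m _ (indicator (c n ≟ k)))

count-hit : ∀ c v → count c (c v) (suc v) ≡ suc (count c (c v) v)
count-hit c v with c v ≟ c v
... | yes _ = refl
... | no ¬p = ⊥-elim (¬p refl)

count-< : ∀ c {v w} → v < w → count c (c v) v < count c (c v) w
count-< c {v} v<w = ≤-trans (≤-reflexive (sym (count-hit c v))) (count-mono c (c v) v<w)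

rank : (ℕ → ℕ) → ℕ → ℕ
rank c v = count c (c v) v

rank-injective : ∀ c {v w} → c v ≡ c w → rank c v ≡ rank c w → v ≡ w
rank-injective c {v} {w} cv≡cw rv≡rw with <-cmp v w
... | tri≈ _ v≡w _ = v≡w
... | tri< v<w _ _ = ⊥-elim (<-irrefl (trans rv≡rw (cong (λ k → count c k w) (sym cv≡cw))) (count-< c v<w))
... | tri> _ _ w<v = ⊥-elim (<-irrefl (trans (sym rv≡rw) (cong (λ k → count c k v) cv≡cw)) (count-< c w<v))

rank-attained : ∀ c k n {i} → i < count c k n → ∃[ v ] c v ≡ k × rank c v ≡ i
rank-attained c k (suc n) {i} i< with c n ≟ k
... | no _ = rank-attained c k n i<
... | yes refl with m≤n⇒m<n∨m≡n (≤-pred i<)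
...   | inj₁ i<′  = rank-attained c k n i<′
...   | inj₂ refl = n , refl , refl

rank-surjective : ∀ c k → (∀ n → ∃[ v ] n ≤ v × c v ≡ k) → ∀ i → ∃[ v ] c v ≡ k × rank c v ≡ i
rank-surjective c k unbounded i = let n , i< = grow (suc i) in rank-attained c k n i<
  where
  grow : ∀ i → ∃[ n ] i ≤ count c k n
  grow zero    = 0 , z≤n
  grow (suc i) with n , i≤ ← grow i with v , n≤v , refl ← unbounded n =
    suc v , ≤-trans (s≤s (≤-trans i≤ (count-mono c k n≤v))) (≤-reflexive (sym (count-hit c v)))

-- An element is matched with the one of the same colour and the same rank
-- within its colour class.
recolour : ∀ (c d : ℕ → ℕ) →
  (∀ v n → ∃[ w ] n ≤ w × d w ≡ c v) → (∀ w n → ∃[ v ] n ≤ v × c v ≡ d w) →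
  ∃[ φ ] (∀ v → d (φ v) ≡ c v) × (∀ {v w} → φ v ≡ φ w → v ≡ w) × (∀ w → ∃[ v ] φ v ≡ w)
recolour c d c⊆d d⊆c = φ , φ-colour , injective , surjective
  where
  match : ∀ v → ∃[ w ] d w ≡ c v × rank d w ≡ rank c v
  match v = rank-surjective d (c v) (c⊆d v) (rank c v)
  φ : ℕ → ℕ
  φ v = proj₁ (match v)
  φ-colour : ∀ v → d (φ v) ≡ c v
  φ-colour v = proj₁ (proj₂ (match v))
  φ-rank : ∀ v → rank d (φ v) ≡ rank c v
  φ-rank v = proj₂ (proj₂ (match v))
  injective : ∀ {v w} → φ v ≡ φ w → v ≡ w
  injective {v} {w} eq = rank-injective c
    (trans (sym (φ-colour v)) (trans (cong d eq) (φ-colour w)))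
    (trans (sym (φ-rank v)) (trans (cong (rank d) eq) (φ-rank w)))
  surjective : ∀ w → ∃[ v ] φ v ≡ w
  surjective w = let v , colour , rk = rank-surjective c (d w) (d⊆c w) (rank d w) in
    v , rank-injective d (trans (φ-colour v) colour) (trans (φ-rank v) rk)

-- Colours code the sets of heights reached: 0 for all of ℕ, suc h for {0..h}.
HasColour : (ℕ → Set) → ℕ → Set
HasColour P zero    = ∀ t → P t
HasColour P (suc h) = ∀ t → P t ⇔ t ≤ h

colour-unique : ∀ {P c d} → HasColour P c → HasColour P d → c ≡ d
colour-unique {c = zero}  {zero}  p q = refl
colour-unique {c = zero}  {suc h} p q = ⊥-elim (<-irrefl refl (to (q (suc h)) (p (suc h))))
colour-unique {c = suc h} {zero}  p q = ⊥-elim (<-irrefl refl (to (p (suc h)) (q (suc h))))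
colour-unique {c = suc h} {suc i} p q =
  cong suc (≤-antisym (to (q h) (from (p h) ≤-refl)) (to (p i) (from (q i) ≤-refl)))

colour-determines : ∀ {P Q} c → HasColour P c → HasColour Q c → ∀ t → P t ⇔ Q t
colour-determines zero    p q t = mk⇔ (λ _ → q t) (λ _ → p t)
colour-determines (suc h) p q t = mk⇔ (from (q t) ∘ to (p t)) (from (p t) ∘ to (q t))

colour-cong : ∀ {P Q : ℕ → Set} c → (∀ t → P t ⇔ Q t) → HasColour P c → HasColour Q c
colour-cong zero    eq p t = to (eq t) (p t)
colour-cong (suc h) eq p t = mk⇔ (to (p t) ∘ from (eq t)) (to (eq t) ∘ from (p t))

DownClosed : (ℕ → Set) → Set
DownClosed P = ∀ {s t} → s ≤ t → P t → P s

module Isomorphism (em : ExcludedMiddle 0ℓ) where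

  has-colour : ∀ {P} → P 0 → DownClosed P → ∃ (HasColour P)
  has-colour {P} p₀ down with em {∃[ t ] ¬ P t}
  ... | no none = 0 , all
    where
    all : ∀ t → P t
    all t with em {P t}
    ... | yes p = p
    ... | no np = ⊥-elim (none (t , np))
  -- The least height missed is a successor because height 0 is reached.
  ... | yes some with least (λ t → em {¬ P t}) some
  ...   | zero  , np , _ = ⊥-elim (np p₀)
  ...   | suc h , np , below = suc h , λ t → mk⇔ (bounded t) (inside t)
    where
    bounded : ∀ t → P t → t ≤ h
    bounded t p with t ≤? h
    ... | yes t≤h = t≤h
    ... | no t≰h = ⊥-elim (np (down (≰⇒> t≰h) p))
    inside : ∀ t → t ≤ h → P t
    inside t t≤h with em {P t}
    ... | yes p = p
    ... | no np′ = ⊥-elim (below t (s≤s t≤h) np′)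

  record Heights (H : ℕ → ℕ → ℕ → Set) : Set where
    field
      base        : ∀ m v → H m v 0
      down-closed : ∀ m v → DownClosed (H m v)

  -- The bound `n` asks for cofinally many partners. Inclusion in both directions makes every
  -- occurring colour class infinite on either side.
  _⊑_ : (H H′ : ℕ → ℕ → ℕ → Set) → Set
  H ⊑ H′ = ∀ m v n → ∃[ w ] n ≤ w × (∀ t → H m v t ⇔ H′ m w t)

  -- Chains and rationals stay fixed, and the tops are permuted within each branch: the position of
  -- a top affects edges only through the heights it reaches.
  Fence-isomorphic : ∀ {H H′} → Heights H → Heights H′ → H ⊑ H′ → H′ ⊑ H → Isomorphic (Fence H) (Fence H′)
  Fence-isomorphic {H} {H′} heights heights′ H⊑H′ H′⊑H = f , record
    { isOrderMonomorphism = record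
      { isOrderHomomorphism = record { cong = cong f ; mono = λ {x} {y} e → mono x y e }
      ; injective = λ {x} {y} → f-injective x y
      ; cancel = λ {x} {y} e → cancel x y e }
    ; surjective = λ y → let x , eq = f-surjective y in x , λ { refl → eq } }
    where
    colour-of : ∀ {H} → Heights H → ∀ m v → ∃ (HasColour (H m v))
    colour-of h m v = has-colour (Heights.base h m v) (Heights.down-closed h m v)

    c d : ℕ → ℕ → ℕ
    c m v = proj₁ (colour-of heights m v)
    d m v = proj₁ (colour-of heights′ m v)

    permutation : ∀ m → ∃[ φ ]
      (∀ v → d m (φ v) ≡ c m v) × (∀ {v w} → φ v ≡ φ w → v ≡ w) × (∀ w → ∃[ v ] φ v ≡ w)
    permutation m = recolour (c m) (d m)
      (λ v n → let w , n≤w , eq = H⊑H′ m v n in w , n≤w ,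
        colour-unique {H′ m w} (proj₂ (colour-of heights′ m w))
          (colour-cong (c m v) eq (proj₂ (colour-of heights m v))))
      (λ w n → let v , n≤v , eq = H′⊑H m w n in v , n≤v ,
        colour-unique {H m v} (proj₂ (colour-of heights m v))
          (colour-cong (d m w) eq (proj₂ (colour-of heights′ m w))))

    φ : ℕ → ℕ → ℕ
    φ m = proj₁ (permutation m)

    φ-height : ∀ m v t → H m v t ⇔ H′ m (φ m v) t
    φ-height m v = colour-determines (c m v) (proj₂ (colour-of heights m v))
      (subst (HasColour (H′ m (φ m v))) (proj₁ (proj₂ (permutation m)) v) (proj₂ (colour-of heights′ m (φ m v))))

    move : ℕ → ℕ → ℕ → ℕ
    move zero    m a = φ m a
    move (suc _) m a = a

    move-injective : ∀ k m {a b} → move k m a ≡ move k m b → a ≡ b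
    move-injective zero    m = proj₁ (proj₂ (proj₂ (permutation m)))
    move-injective (suc _) m = id

    move-surjective : ∀ k m b → ∃[ a ] move k m a ≡ b
    move-surjective zero    m = proj₂ (proj₂ (proj₂ (permutation m)))
    move-surjective (suc _) m b = b , refl

    move-mono : ∀ {k m a k′ m′ a′} → Edge H k m a k′ m′ a′ → Edge H′ k m (move k m a) k′ m′ (move k′ m′ a′)
    move-mono (along p)   = along p
    move-mono (left p)    = left p
    move-mono (right p)   = right p
    move-mono (reach p h) = reach p (to (φ-height _ _ _) h)

    move-cancel : ∀ k {m a} k′ {m′ a′} → Edge H′ k m (move k m a) k′ m′ (move k′ m′ a′) → Edge H k m a k′ m′ a′
    move-cancel (suc k) (suc l) (along p) = along p
    move-cancel (suc k) (suc l) (left p)  = left p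
    move-cancel (suc k) (suc l) (right p) = right p
    move-cancel (suc k) zero    (left p)  = left p
    move-cancel (suc k) zero    (right p) = right p
    move-cancel (suc k) zero    (reach p h) = reach p (from (φ-height _ _ _) h)

    f : ℕ → ℕ
    f x = element (kind x) (branch x) (move (kind x) (branch x) (position x))

    mono : ∀ x y → Fence H x y → Fence H′ (f x) (f y)
    mono x y e = subst id (sym (Fence-element _ _ _ _ _ _)) (move-mono e)

    cancel : ∀ x y → Fence H′ (f x) (f y) → Fence H x y
    cancel x y e = move-cancel (kind x) (kind y) (subst id (Fence-element _ _ _ _ _ _) e)

    f-injective : ∀ x y → f x ≡ f y → x ≡ y
    f-injective x y eq
      with k≡ , rest ← pair-injective eq
      with m≡ , a≡ ← pair-injective rest =
      trans (sym (element-η x)) (trans (cong₂ pair k≡ (cong₂ pair m≡ (move-injective (kind y) (branch y)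
        (trans (sym (cong₂ (λ k m → move k m (position x)) k≡ m≡)) a≡)))) (element-η y))

    f-surjective : ∀ y → ∃[ x ] f x ≡ y
    f-surjective y with a , eq ← move-surjective (kind y) (branch y) (position y) =
      element (kind y) (branch y) a , trans
      (cong₂ pair (kind-element _ _ _) (cong₂ pair (branch-element _ _ _)
        (trans (move-cong (kind-element _ _ _) (branch-element _ _ _) (position-element _ _ _)) eq)))
      (element-η y)
      where
      move-cong : ∀ {k k′ m m′ a a′} → k ≡ k′ → m ≡ m′ → a ≡ a′ → move k m a ≡ move k′ m′ a′
      move-cong refl refl refl = refl

module _ {O : Pred ℕ 0ℓ} where

  ∀<ʳ : ∀ {P : ℕ → ℕ → Set} {N} → Recursive O (λ z → P (fst z) (snd z)) → Computable O N →
    Recursive O (λ x → ∀ k → k < N x → P x k)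
  ∀<ʳ {P} {N} (recursive F f p) n = recursive (λ x → rec 0 (λ k r → F (pair x k) + r) (N x))
    (rec-computable {H = λ x k r → F (pair x k) + r} (const-computable 0)
      (ap₂ +-computable (f ⊙ pair-computable fst-computable (fst-computable ⊙ snd-computable))
        (snd-computable ⊙ snd-computable)) n)
    λ x → mk⇔ (vanishes x (N x)) (holds x (N x))
    where
    P⇔ : ∀ x k → P x k ⇔ F (pair x k) ≡ 0
    P⇔ x k = mk⇔ (to (p _) ∘ subst₂ P (sym (fst-pair x k)) (sym (snd-pair x k)))
                 (subst₂ P (fst-pair x k) (snd-pair x k) ∘ from (p _))
    vanishes : ∀ x n → (∀ k → k < n → P x k) → rec 0 (λ k r → F (pair x k) + r) n ≡ 0
    vanishes x zero    all = refl
    vanishes x (suc n) all = cong₂ _+_ (to (P⇔ x n) (all n ≤-refl)) (vanishes x n λ k k<n → all k (m≤n⇒m≤1+n k<n))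
    holds : ∀ x n → rec 0 (λ k r → F (pair x k) + r) n ≡ 0 → ∀ k → k < n → P x k
    holds x (suc n) eq k (s≤s k≤n) with m≤n⇒m<n∨m≡n k≤n
    ... | inj₁ k<n  = holds x n (m+n≡0⇒n≡0 (F (pair x n)) eq) k k<n
    ... | inj₂ refl = from (P⇔ x n) (m+n≡0⇒m≡0 (F (pair x n)) eq)

  <ℚʳ : ∀ {U V} → Computable O U → Computable O V → Recursive O (λ x → U x <ℚ V x)
  <ℚʳ u v = <ʳ
    (ap₂ *-computable (suc-computable ⊙ fst-computable ⊙ u) (suc-computable ⊙ snd-computable ⊙ v))
    (ap₂ *-computable (suc-computable ⊙ fst-computable ⊙ v) (suc-computable ⊙ snd-computable ⊙ u))

module _ {O : Pred ℕ 0ℓ} where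

  ∃<ʳ : ∀ {P : ℕ → ℕ → Set} {N} → Recursive O (λ z → P (fst z) (snd z)) → Computable O N →
    Recursive O (λ x → ∃[ k ] k < N x × P x k)
  ∃<ʳ {P} {N} r n = recursive-cong
    (λ x → mk⇔ (search x) (λ (k , k<n , pk) none → none k k<n pk))
    (¬ʳ ∀<ʳ {P = λ x k → ¬ P x k} (¬ʳ r) n)
    where
    P? : ∀ x k → Dec (P x k)
    P? x k with recursive-dec r (pair x k)
    ... | yes p = yes (subst₂ P (fst-pair x k) (snd-pair x k) p)
    ... | no np = no (np ∘ subst₂ P (sym (fst-pair x k)) (sym (snd-pair x k)))
    search : ∀ x → ¬ (∀ k → k < N x → ¬ P x k) → ∃[ k ] k < N x × P x k
    search x ¬none with anyUpTo? (P? x) (N x)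
    ... | yes found = found
    ... | no none = ⊥-elim (¬none λ k k<n pk → none (k , k<n , pk))

-- One bound for all witnesses pulls the unbounded quantifier out of the bounded one, so that
-- reaching a height becomes a single search.
collect : ∀ {P : ℕ → ℕ → Set} n → (∀ k → k < n → ∃ (P k)) ⇔ (∃[ b ] ∀ k → k < n → ∃[ r ] r < b × P k r)
collect {P} n = mk⇔ (bound n) (λ (b , all) k k<n → let r , _ , p = all k k<n in r , p)
  where
  bound : ∀ n → (∀ k → k < n → ∃ (P k)) → ∃[ b ] ∀ k → k < n → ∃[ r ] r < b × P k r
  bound zero    all = 0 , λ _ ()
  bound (suc n) all with b , bounded ← bound n (λ k k<n → all k (m≤n⇒m≤1+n k<n)) | r , p ← all n ≤-refl =
    b + suc r , go
    where
    go : ∀ k → k < suc n → ∃[ s ] s < b + suc r × P k s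
    go k (s≤s k≤n) with m≤n⇒m<n∨m≡n k≤n
    ... | inj₁ k<n = let s , s<b , q = bounded k k<n in s , ≤-trans s<b (m≤m+n b (suc r)) , q
    ... | inj₂ refl = r , m≤n+m (suc r) b , p

-- Computably enumerable fences

-- Tops ⟨ 0 , ⟨ h , j ⟩ ⟩ have height h, so that all finite heights occur
-- cofinally often; the heights of the other tops are prescribed by G.
Padded : (ℕ → ℕ → ℕ → Set) → ℕ → ℕ → ℕ → Set
Padded G m v t = (fst v ≡ 0 × t ≤ fst (snd v)) ⊎ (fst v ≢ 0 × G m (fst (snd v)) t)

module Padding (em : ExcludedMiddle 0ℓ) where
  open Isomorphism em

  Padded-heights : ∀ {G} → Heights G → Heights (Padded G)
  Padded-heights {G} h = record { base = base′ ; down-closed = down }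
    where
    base′ : ∀ m v → Padded G m v 0
    base′ m v with fst v ≟ 0
    ... | yes eq = inj₁ (eq , z≤n)
    ... | no neq = inj₂ (neq , Heights.base h m _)
    down : ∀ m v → DownClosed (Padded G m v)
    down m v s≤t (inj₁ (eq , t≤)) = inj₁ (eq , ≤-trans s≤t t≤)
    down m v s≤t (inj₂ (neq , g)) = inj₂ (neq , Heights.down-closed h m _ s≤t g)

  padded-finite : ∀ {P : ℕ → Set} G m n i → (∀ t → P t ⇔ t ≤ i) → ∃[ w ] n ≤ w × (∀ t → P t ⇔ Padded G m w t)
  -- The last component serves only to push the code beyond `n`.
  padded-finite G m n i spec = pair 0 (pair i n) , ≤-trans (n≤pair i n) (n≤pair 0 _) , λ t → mk⇔
    (λ g → inj₁ (fst-pair _ _ , ≤-trans (to (spec t) g) (≤-reflexive (sym height))))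
    (λ { (inj₁ (_ , t≤)) → from (spec t) (≤-trans t≤ (≤-reflexive height))
       ; (inj₂ (neq , _)) → ⊥-elim (neq (fst-pair _ _)) })
    where
    height : fst (snd (pair 0 (pair i n))) ≡ i
    height = trans (cong fst (snd-pair _ _)) (fst-pair _ _)

  padded-infinite : ∀ G m n p → (∀ t → G m p t) → ∃[ w ] n ≤ w × (∀ t → Padded G m w t)
  padded-infinite G m n p all = pair 1 (pair p n) , ≤-trans (n≤pair p n) (n≤pair 1 _) , λ t →
    inj₂ ((λ eq → 1+n≢0 (trans (sym (fst-pair _ _)) eq)) ,
      subst (λ p → G m p t) (sym (trans (cong fst (snd-pair _ _)) (fst-pair _ _))) (all t))

  -- Padding supplies every finite height, so only the existence of an unbounded top has to carry
  -- over.
  Padded-⊑ : ∀ {G G′} → Heights G →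
    (∀ m → (∃[ p ] ∀ t → G m p t) → ∃[ p ] ∀ t → G′ m p t) → Padded G ⊑ Padded G′
  Padded-⊑ {G} {G′} h infinite m v n with fst v ≟ 0
  ... | yes eq = padded-finite G′ m n (fst (snd v)) λ t → mk⇔
      (λ { (inj₁ (_ , t≤)) → t≤ ; (inj₂ (neq , _)) → ⊥-elim (neq eq) }) (λ t≤ → inj₁ (eq , t≤))
  ... | no neq with has-colour (Heights.base h m (fst (snd v))) (Heights.down-closed h m (fst (snd v)))
  ...   | suc i , spec = padded-finite G′ m n i λ t → mk⇔
      (λ { (inj₁ (eq , _)) → ⊥-elim (neq eq) ; (inj₂ (_ , g)) → to (spec t) g })
      (λ t≤ → inj₂ (neq , from (spec t) t≤))
  ...   | zero , spec
      with q , all ← infinite m (fst (snd v) , spec)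
      with w , n≤w , all′ ← padded-infinite G′ m n q all =
      w , n≤w , λ t → mk⇔ (λ _ → all′ t) (λ _ → inj₂ (neq , spec t))

-- An edge with all existential quantifiers merged into the search for w.
EdgeWith : (ℕ → ℕ → ℕ → ℕ → Set) → (k m a k′ m′ a′ w : ℕ) → Set
EdgeWith K k m a k′ m′ a′ w =
  (1 ≤ k × k ≡ k′ × m ≡ m′ × a <ℚ a′) ⊎
  (2 ≤ k × k′ ≤ 1 × (m′ ≡ m ⊎ m′ ≡ suc m)) ⊎
  (k ≡ 1 × k′ ≡ 0 × m ≡ m′ × a <ℚ pair (fst w) 0 × K m a′ (fst w) (snd w))

edge⇔edgeWith : ∀ {H K} → (∀ m v t → H m v t ⇔ ∃ (K m v t)) →
  ∀ k m a k′ m′ a′ → Edge H k m a k′ m′ a′ ⇔ ∃ (EdgeWith K k m a k′ m′ a′)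
edge⇔edgeWith {H} {K} H⇔ k m a k′ m′ a′ = mk⇔ merge split
  where
  merge : ∀ {k m a k′ m′ a′} → Edge H k m a k′ m′ a′ → ∃ (EdgeWith K k m a k′ m′ a′)
  merge (along p) = 0 , inj₁ (s≤s z≤n , refl , refl , p)
  merge (left p)  = 0 , inj₂ (inj₁ (s≤s (s≤s z≤n) , p , inj₁ refl))
  merge (right p) = 0 , inj₂ (inj₁ (s≤s (s≤s z≤n) , p , inj₂ refl))
  merge {m = m} {a} {a′ = v} (reach {t = t} p h) with r , q ← to (H⇔ _ _ _) h = pair t r , inj₂ (inj₂
    (refl , refl , refl , subst (λ t → a <ℚ pair t 0) (sym (fst-pair t r)) p ,
     subst₂ (K m v) (sym (fst-pair t r)) (sym (snd-pair t r)) q))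
  split : ∀ {k m a k′ m′ a′} → ∃ (EdgeWith K k m a k′ m′ a′) → Edge H k m a k′ m′ a′
  split (w , inj₁ (s≤s _ , refl , refl , p)) = along p
  split (w , inj₂ (inj₁ (s≤s (s≤s _) , p , inj₁ refl))) = left p
  split (w , inj₂ (inj₁ (s≤s (s≤s _) , p , inj₂ refl))) = right p
  split (w , inj₂ (inj₂ (refl , refl , refl , p , q))) = reach p (from (H⇔ _ _ _) (snd w , q))

edgeWithʳ : ∀ {O} {K : ℕ → ℕ → ℕ → ℕ → Set} {k m a k′ m′ a′ w : ℕ → ℕ} →
  Computable O k → Computable O m → Computable O a → Computable O k′ → Computable O m′ → Computable O a′ →
  Computable O w → Recursive O (λ z → K (m z) (a′ z) (fst (w z)) (snd (w z))) →
  Recursive O (λ z → EdgeWith K (k z) (m z) (a z) (k′ z) (m′ z) (a′ z) (w z))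
edgeWithʳ k m a k′ m′ a′ w K =
  (≤ʳ (const-computable 1) k ∧ʳ ≡ʳ k k′ ∧ʳ ≡ʳ m m′ ∧ʳ <ℚʳ a a′) ∨ʳ
  (≤ʳ (const-computable 2) k ∧ʳ ≤ʳ k′ (const-computable 1) ∧ʳ (≡ʳ m′ m ∨ʳ ≡ʳ m′ (suc-computable ⊙ m))) ∨ʳ
  (≡ʳ k (const-computable 1) ∧ʳ ≡ʳ k′ (const-computable 0) ∧ʳ ≡ʳ m m′ ∧ʳ
   <ℚʳ a (pair-computable (fst-computable ⊙ w) (const-computable 0)) ∧ʳ K)

Fence-ce : ∀ {O H} {K : ℕ → ℕ → ℕ → ℕ → Set} → (∀ m v t → H m v t ⇔ ∃ (K m v t)) →
  (∀ {m v t r} → Computable O m → Computable O v → Computable O t → Computable O r →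
    Recursive O (λ z → K (m z) (v z) (t z) (r z))) →
  CEIn O (Fence H)
Fence-ce {O} {H} {K} H⇔ Kʳ = proj₁ halts , λ x y →
  subst (λ c → Fence H x y ⇔ Halts O (proj₁ halts) c) (pair≡⟨,⟩ x y) (mk⇔
    (to (proj₂ halts (pair x y)) ∘ to (unpacked x y) ∘ to (edges x y))
    (from (edges x y) ∘ from (unpacked x y) ∘ from (proj₂ halts (pair x y))))
  where
  At : ℕ → ℕ → ℕ → Set
  At x y = EdgeWith K (kind x) (branch x) (position x) (kind y) (branch y) (position y)

  edges : ∀ x y → Fence H x y ⇔ ∃ (At x y)
  edges x y = edge⇔edgeWith H⇔ _ _ _ _ _ _

  unpacked : ∀ x y → ∃ (At x y) ⇔ ∃ (At (fst (pair x y)) (snd (pair x y)))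
  unpacked x y rewrite fst-pair x y | snd-pair x y = mk⇔ id id

  halts : ∃[ e ] ∀ z → ∃ (At (fst z) (snd z)) ⇔ Halts O e z
  halts = ∃-halts (edgeWithʳ {K = K}
    (fst-computable ⊙ x) (fst-computable ⊙ snd-computable ⊙ x) (snd-computable ⊙ snd-computable ⊙ x)
    (fst-computable ⊙ y) (fst-computable ⊙ snd-computable ⊙ y) (snd-computable ⊙ snd-computable ⊙ y)
    snd-computable (Kʳ (fst-computable ⊙ snd-computable ⊙ x) (snd-computable ⊙ snd-computable ⊙ y)
      (fst-computable ⊙ snd-computable) (snd-computable ⊙ snd-computable)))
    where
    x = fst-computable ⊙ fst-computable
    y = snd-computable ⊙ fst-computable

Coded : Pred ℕ 0ℓ → ℕ → Set
Coded A m = (A (fst m) × snd m ≡ 1) ⊎ (¬ A (fst m) × snd m ≡ 0)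

-- Infinite height on coded branches and height 0 elsewhere, where the padding makes it harmless.
Target : Pred ℕ 0ℓ → ℕ → ℕ → ℕ → Set
Target A m _ t = t ≡ 0 ⊎ Coded A m

Canonical : Pred ℕ 0ℓ → ℕ → ℕ → ℕ → Set
Canonical A = Padded (Target A)

canonical-unbounded : ∀ A m → (∃[ v ] ∀ t → Canonical A m v t) ⇔ Coded A m
-- One more than the height that padding would give `v`: this excludes a padded top and, being
-- positive, also the default height 0.
canonical-unbounded A m = mk⇔ (λ (v , all) → extract v (all (suc (fst (snd v)))))
  λ coded → pair 1 0 , λ t → inj₂ ((λ eq → 1+n≢0 (trans (sym (fst-pair 1 0)) eq)) , inj₂ coded)
  where
  extract : ∀ v → Canonical A m v (suc (fst (snd v))) → Coded A m
  extract v (inj₁ (_ , t≤))          = ⊥-elim (<-irrefl refl t≤)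
  extract v (inj₂ (_ , inj₂ coded)) = coded

-- From a reduction to a c.e. copy.

module Construction (em : ExcludedMiddle 0ℓ) where
  open Isomorphism em
  open Padding em
  open Limits em

  target-heights : ∀ A → Heights (Target A)
  target-heights A = record
    { base = λ _ _ → inj₁ refl
    ; down-closed = λ { _ _ z≤n (inj₁ refl) → inj₁ refl ; _ _ _ (inj₂ coded) → inj₂ coded } }

  canonical-heights : ∀ A → Heights (Canonical A)
  canonical-heights A = Padded-heights (target-heights A)

  coded⇔eval : ∀ A O e → (∀ x → (A x → Eval O e x 1) × (¬ A x → Eval O e x 0)) →
    ∀ m → Coded A m ⇔ Eval O e (fst m) (snd m)
  coded⇔eval A O e decides m = mk⇔
    (λ { (inj₁ (a , eq)) → subst (Eval O e (fst m)) (sym eq) (proj₁ (decides _) a)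
       ; (inj₂ (na , eq)) → subst (Eval O e (fst m)) (sym eq) (proj₂ (decides _) na) })
    decode
    where
    decode : Eval O e (fst m) (snd m) → Coded A m
    decode ev with em {A (fst m)}
    ... | yes a = inj₁ (a , Eval-functional e ev (proj₁ (decides _) a))
    ... | no na = inj₂ (na , Eval-functional e ev (proj₂ (decides _) na))

  Climbing : (ℕ → ℕ → ℕ → Set) → ℕ → ℕ → ℕ → Set
  Climbing E m p t = ∀ s → s < t → ∃ (E (pair m p) s)

  climbing-heights : ∀ E → Heights (Climbing E)
  climbing-heights E = record
    { base = λ _ _ _ ()
    ; down-closed = λ _ _ s≤t climb r r<s → climb r (≤-trans r<s s≤t) }

  climbing-unbounded : ∀ {E} m p → (∀ t → ∃ (E (pair m p) t)) ⇔ (∀ t → Climbing E m p t)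
  climbing-unbounded m p = mk⇔ (λ all t s _ → all s) (λ climb t → climb (suc t) t ≤-refl)

  climbing-ce : ∀ {O E} → Recursive O (λ z → E (fst (fst z)) (snd (fst z)) (snd z)) →
    CEIn O (Fence (Padded (Climbing E)))
  climbing-ce {O} {E} r = Fence-ce {K = K} Padded⇔ λ {m} {v} {t} {z} m-c v-c t-c z-c →
    (≡ʳ (fst-computable ⊙ v-c) (const-computable 0) ∧ʳ ≤ʳ t-c (fst-computable ⊙ snd-computable ⊙ v-c)) ∨ʳ
    (¬ʳ ≡ʳ (fst-computable ⊙ v-c) (const-computable 0) ∧ʳ
     ∀<ʳ {P = λ x s → ∃[ r ] r < z x × E (pair (m x) (fst (snd (v x)))) s r}
       (∃<ʳ {P = λ y r → E (pair (m (fst y)) (fst (snd (v (fst y))))) (snd y) r}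
         (E-at (pair-computable (m-c ⊙ fst-computable ⊙ fst-computable)
                 (fst-computable ⊙ snd-computable ⊙ v-c ⊙ fst-computable ⊙ fst-computable))
           (snd-computable ⊙ fst-computable) snd-computable)
         (z-c ⊙ fst-computable))
       t-c)
    where
    E-at : ∀ {w s r} → Computable O w → Computable O s → Computable O r → Recursive O (λ x → E (w x) (s x) (r x))
    E-at {w} {s} {q} w-c s-c r-c = recursive-cong
      (λ x → mk⇔ (subst id (unpack (w x) (s x) (q x))) (subst id (sym (unpack (w x) (s x) (q x)))))
      (r ⟪ pair-computable (pair-computable w-c s-c) r-c ⟫)
      where
      unpack : ∀ w s r →
        E (fst (fst (pair (pair w s) r))) (snd (fst (pair (pair w s) r))) (snd (pair (pair w s) r)) ≡ E w s r
      unpack w s r rewrite fst-pair (pair w s) r | snd-pair (pair w s) r | fst-pair w s | snd-pair w s = refl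
    K : ℕ → ℕ → ℕ → ℕ → Set
    K m v t z = (fst v ≡ 0 × t ≤ fst (snd v)) ⊎
                (fst v ≢ 0 × (∀ s → s < t → ∃[ r ] r < z × E (pair m (fst (snd v))) s r))
    Padded⇔ : ∀ m v t → Padded (Climbing E) m v t ⇔ ∃ (K m v t)
    Padded⇔ m v t = mk⇔
      (λ { (inj₁ fixed) → 0 , inj₁ fixed
         ; (inj₂ (neq , climb)) → let b , all = to (collect t) climb in b , inj₂ (neq , all) })
      (λ { (_ , inj₁ fixed) → inj₁ fixed
         ; (b , inj₂ (neq , all)) → inj₂ (neq , from (collect t) (b , all)) })

  ce-copy : ∀ A X → A ≤T jump (jump X) → ∃[ R ] CEIn X R × Isomorphic R (Fence (Canonical A))
  ce-copy A X (e , decides) with E , E-recursive , E⇔ ← Σ₃-form X e =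
    Fence (Padded (Climbing E)) , climbing-ce {E = E} E-recursive ,
    Fence-isomorphic (Padded-heights (climbing-heights E)) (canonical-heights A)
      (Padded-⊑ {Climbing E} {Target A} (climbing-heights E) λ m (p , climb) →
        -- `Target` treats all indices of a coded branch alike, so 0 serves.
        0 , λ t → inj₂ (from (coded⇔Σ₃ m) (p , from (climbing-unbounded {E} m p) climb)))
      (Padded-⊑ {Target A} {Climbing E} (target-heights A) λ m (p , all) →
        let q , found = to (coded⇔Σ₃ m) (coded m all) in q , to (climbing-unbounded {E} m q) found)
    where
    coded⇔Σ₃ : ∀ m → Coded A m ⇔ (∃[ p ] ∀ t → ∃ (E (pair m p) t))
    coded⇔Σ₃ m = mk⇔ (to (E⇔ m) ∘ to coded⇔) (from coded⇔ ∘ from (E⇔ m))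
      where coded⇔ = coded⇔eval A (jump (jump X)) e decides m
    coded : ∀ m → (∀ t → t ≡ 0 ⊎ Coded A m) → Coded A m
    coded m all with all 1
    ... | inj₂ c = c

-- Recognising branches and heights in a computably enumerable copy

module _ {H : ℕ → ℕ → ℕ → Set} where

  no-common-lower-bound : ∀ {l i d m a c} → Edge H l i d 1 m a → ¬ Edge H l i d 1 (2 + m) c
  no-common-lower-bound (along _) ()
  no-common-lower-bound (left _)  ()
  no-common-lower-bound (right _) ()

  -- The four premises are comparabilities of ⟨ k , ⟨ n , c ⟩ ⟩ in the fence
  -- with given elements of the branches m and m + 1.
  third-branch : ∀ {m a b k n c} →
    (∃[ l ] ∃[ i ] ∃[ d ] Edge H l i d 1 (suc m) b × Edge H l i d k n c) →
    (∀ l i d → Edge H l i d 1 m a → ¬ Edge H l i d k n c) →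
    ¬ Edge H k n c 1 (suc m) b →
    (∃[ l ] ∃[ i ] ∃[ d ] Edge H k n c l i d) →
    k ≡ 1 × n ≡ 2 + m
  -- `2 m 0` is a point of a chain linking the branches m and m + 1, so it lies below `a` and below
  -- everything on branch m + 1.
  third-branch {m} (_ , _ , _ , along _ , along _)     ¬uw _ _ = ⊥-elim (¬uw 2 m 0 (left ≤-refl) (right ≤-refl))
  third-branch {m} (_ , _ , _ , along _ , reach _ _)   ¬uw _ _ = ⊥-elim (¬uw 2 m 0 (left ≤-refl) (right z≤n))
  third-branch     (_ , _ , _ , left _ , along _)      _ ¬wv _ = ⊥-elim (¬wv (left ≤-refl))
  third-branch {m} (_ , _ , _ , left _ , left p)       ¬uw _ _ = ⊥-elim (¬uw 2 m 0 (left ≤-refl) (right p))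
  third-branch     (_ , _ , _ , left _ , right z≤n)    _ _ (_ , _ , _ , ())
  third-branch     (_ , _ , _ , left _ , right (s≤s z≤n)) _ _ _ = refl , refl
  third-branch     (_ , _ , _ , right _ , along _)     _ ¬wv _ = ⊥-elim (¬wv (right ≤-refl))
  third-branch     (l , i , d , right _ , left p)      ¬uw _ _ = ⊥-elim (¬uw l i d (left ≤-refl) (left p))
  third-branch     (l , i , d , right _ , right p)     ¬uw _ _ = ⊥-elim (¬uw l i d (left ≤-refl) (right p))

  branch-ascent : ∀ {m a b} → ¬ Edge H 1 (suc m) a 1 m b
  branch-ascent ()

  -- An element above a branch point with something above itself can only be a rational of the same
  -- branch, and an infinite top exceeds all of those.
  maximal-above-chain : ∀ {m a k n c l i d v} → (∀ t → H m v t) →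
    Edge H 1 m a k n c → Edge H k n c l i d → Edge H k n c 0 m v
  maximal-above-chain all (along {b = c} p) _ = reach (<ℚ-natural c 0) (all _)

record _≅_ (R S : Rel ℕ 0ℓ) : Set where
  field
    f  : ℕ → ℕ
    g  : ℕ → ℕ
    fg : ∀ y → f (g y) ≡ y
    mono   : ∀ {x y} → R x y → S (f x) (f y)
    cancel : ∀ {x y} → S (f x) (f y) → R x y

isomorphic⇒≅ : ∀ {R S} → Isomorphic R S → R ≅ S
isomorphic⇒≅ (f , iso) = record
  { f = f ; g = λ y → proj₁ (surjective y) ; fg = λ y → proj₂ (surjective y) refl
  ; mono = mono ; cancel = cancel }
  where open IsOrderIsomorphism iso

-- From a c.e. copy to a reduction.

module Recognition (em : ExcludedMiddle 0ℓ) where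
  open Classical em
  open Isomorphism em
  open Construction em

  opaque
    RunsFor : Pred ℕ 0ℓ → Code → ℕ → ℕ → Set
    RunsFor O e x n = fst (run (χ O) n (program e x)) ≡ 0

    runsForʳ : ∀ {O} e → Recursive O (λ z → RunsFor O e (fst z) (snd z))
    runsForʳ {O} e =
      ≡ʳ (fst-computable ⊙ run-computable {o = λ _ → χ O} (curried (χ-computable ⊙ snd-computable)) snd-computable
           (pair-computable (const-computable (cons (encode e) 0)) fst-computable)) (const-computable 0)

    halts⇔runsFor : ∀ {O} e x → Halts O e x ⇔ ∃ (RunsFor O e x)
    halts⇔runsFor {O} e x = mk⇔
      (λ (y , p) → let n , q = to (eval⇔run e x y) p in n , trans (cong fst q) (fst-pair 0 y))
      (λ (n , q) → _ , from (eval⇔run e x _)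
        (n , trans (sym (pair-fst-snd _)) (cong (λ K → pair K (snd (run (χ O) n (program e x)))) q)))
      where open Simulation (χ-spec O)

  -- Kleene's normal form: the witness is the number of steps until the interpreter halts.
  ce-projection : ∀ {X R} → CEIn X R →
    ∃[ S ] Recursive X (λ z → S (fst z) (snd z)) × (∀ x y → R x y ⇔ ∃ (S (pair x y)))
  ce-projection {X} {R} (e , R⇔) = RunsFor X e , runsForʳ e , λ x y →
    let halts⇔ = halts⇔runsFor {X} e (pair x y) in mk⇔
      (λ r → to halts⇔ (subst (Halts X e) (sym (pair≡⟨,⟩ x y)) (to (R⇔ x y) r)))
      (λ s → from (R⇔ x y) (subst (Halts X e) (pair≡⟨,⟩ x y) (from halts⇔ s)))

  module _ {X : Pred ℕ 0ℓ} {R : Rel ℕ 0ℓ} (ce : CEIn X R) where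

    S : ℕ → ℕ → Set
    S = proj₁ (ce-projection ce)

    S-at : ∀ {u v w} → Computable X u → Computable X v → Computable X w →
      Recursive X (λ x → S (pair (u x) (v x)) (w x))
    S-at {u} {v} {w} u-c v-c w-c = recursive-cong
      (λ x → mk⇔ (subst₂ S (fst-pair _ _) (snd-pair _ _)) (subst₂ S (sym (fst-pair _ _)) (sym (snd-pair _ _))))
      (proj₁ (proj₂ (ce-projection ce)) ⟪ pair-computable (pair-computable u-c v-c) w-c ⟫)

    R⇔S : ∀ x y → R x y ⇔ ∃ (S (pair x y))
    R⇔S = proj₂ (proj₂ (ce-projection ce))

    relationʳ : ∀ {u v} → Computable X u → Computable X v → Recursive (jump X) (λ x → R (u x) (v x))
    relationʳ {u} {v} u-c v-c = recursive-cong (λ x → mk⇔ (from (R⇔S _ _)) (to (R⇔S _ _)))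
      (∃ʳ {P = λ x w → S (pair (u x) (v x)) w} (S-at (u-c ⊙ fst-computable) (v-c ⊙ fst-computable) snd-computable))

    -- The lower bound and both enumeration witnesses are found in one search, so a single jump is
    -- enough.
    common-lower-boundʳ : ∀ {u v} → Computable X u → Computable X v →
      Recursive (jump X) (λ x → ∃[ q ] R q (u x) × R q (v x))
    common-lower-boundʳ {u} {v} u-c v-c = recursive-cong
      (λ x → mk⇔ {A = ∃ (λ w → S (pair (fst w) (u x)) (fst (snd w)) × S (pair (fst w) (v x)) (snd (snd w)))}
        (λ (w , s , t) → fst w , from (R⇔S _ _) (_ , s) , from (R⇔S _ _) (_ , t))
        (λ (q , r , r′) → let s , p = to (R⇔S _ _) r ; t , p′ = to (R⇔S _ _) r′ in pair q (pair s t) ,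
          subst₂ (λ q s → S (pair q (u x)) s) (sym (fst-pair _ _))
            (sym (trans (cong fst (snd-pair _ _)) (fst-pair _ _))) p ,
          subst₂ (λ q t → S (pair q (v x)) t) (sym (fst-pair _ _))
            (sym (trans (cong snd (snd-pair _ _)) (snd-pair _ _))) p′))
      (∃ʳ {P = λ x w → S (pair (fst w) (u x)) (fst (snd w)) × S (pair (fst w) (v x)) (snd (snd w))}
        (S-at (fst-computable ⊙ snd-computable) (u-c ⊙ fst-computable)
           (fst-computable ⊙ snd-computable ⊙ snd-computable) ∧ʳ
         S-at (fst-computable ⊙ snd-computable) (v-c ⊙ fst-computable)
           (snd-computable ⊙ snd-computable ⊙ snd-computable)))

    not-maximalʳ : ∀ {u} → Computable X u → Recursive (jump X) (λ x → ∃[ q ] R (u x) q)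
    not-maximalʳ {u} u-c = recursive-cong
      (λ x → mk⇔ {A = ∃ (λ w → S (pair (u x) (fst w)) (snd w))}
        (λ (w , s) → fst w , from (R⇔S _ _) (_ , s))
        (λ (q , r) → let s , p = to (R⇔S _ _) r in pair q s ,
          subst₂ (λ q s → S (pair (u x) q) s) (sym (fst-pair _ _)) (sym (snd-pair _ _)) p))
      (∃ʳ {P = λ x w → S (pair (u x) (fst w)) (snd w)}
        (S-at (u-c ⊙ fst-computable) (fst-computable ⊙ snd-computable) (snd-computable ⊙ snd-computable)))

    -- For `u`, `v` on consecutive branches: the first clause keeps `w` near `v`, the second rules
    -- out the two branches already visited, the third the chains below `v`, and the last the tops.
    Third : ℕ → ℕ → ℕ → Set
    Third u v w = (∃[ q ] R q v × R q w) × (¬ (∃[ q ] R q u × R q w)) × (¬ R w v) × (∃[ q ] R w q)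

    Next : ℕ → ℕ → Set
    Next s w = Third (fst s) (snd s) w

    nextʳ : Recursive (jump X) (λ z → Next (fst z) (snd z))
    nextʳ = common-lower-boundʳ (snd-computable ⊙ fst-computable) snd-computable ∧ʳ
      ¬ʳ common-lower-boundʳ (fst-computable ⊙ fst-computable) snd-computable ∧ʳ
      ¬ʳ relationʳ snd-computable (snd-computable ⊙ fst-computable) ∧ʳ
      not-maximalʳ snd-computable

    opaque
      -- Most pairs have no successor, while `choiceʳ` needs a total search. The second disjunct
      -- lets it stop there, at the cost of the second jump.
      next-function : ∃[ M ] Computable (jump (jump X)) M × (∀ s → ∃ (Next s) → Next s (M s))
      next-function =
        let M , M-computable , spec = choiceʳ {P = λ s w → Next s w ⊎ ¬ ∃ (Next s)}
              (jumpʳ nextʳ ∨ʳ ¬ʳ (∃ʳ {P = Next} nextʳ ⟪ fst-computable ⟫)) total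
        in M , M-computable , λ s ex → prune ex (spec s)
        where
        total : ∀ s → ∃[ w ] (Next s w ⊎ ¬ ∃ (Next s))
        total s with em {∃ (Next s)}
        ... | yes (w , n) = w , inj₁ n
        ... | no none = 0 , inj₂ none
        prune : ∀ {P Q : Set} → Q → P ⊎ ¬ Q → P
        prune q (inj₁ p)  = p
        prune q (inj₂ nq) = ⊥-elim (nq q)

    -- `q` packs an element above `u` with a witness that it is not maximal. The matrix is decidable
    -- in one jump, so the quantifier takes the second.
    Dominates : ℕ → ℕ → Set
    Dominates u y = R u y × ¬ (∃[ q ] R u (fst q) × R (fst q) (snd q) × ¬ R (fst q) y)

    dominatesʳ : ∀ {u y} → Computable (jump (jump X)) u → Computable (jump (jump X)) y →
      Recursive (jump (jump X)) (λ x → Dominates (u x) (y x))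
    dominatesʳ {u} {y} u-c y-c = recursive-cong
      (λ x → mk⇔ (subst₂ Dominates (fst-pair _ _) (snd-pair _ _))
                 (subst₂ Dominates (sym (fst-pair _ _)) (sym (snd-pair _ _))))
      ((jumpʳ (relationʳ fst-computable snd-computable) ∧ʳ
        ¬ʳ ∃ʳ {P = λ x q → R (fst x) (fst q) × R (fst q) (snd q) × ¬ R (fst q) (snd x)}
          (relationʳ (fst-computable ⊙ fst-computable) (fst-computable ⊙ snd-computable) ∧ʳ
           relationʳ (fst-computable ⊙ snd-computable) (snd-computable ⊙ snd-computable) ∧ʳ
           ¬ʳ relationʳ (fst-computable ⊙ snd-computable) (snd-computable ⊙ fst-computable)))
       ⟪ pair-computable u-c y-c ⟫)

  -- The double negation is what the negated existential in `Dominates` yields.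
  Dominating : ∀ (H : ℕ → ℕ → ℕ → Set) m a k n c → Set
  Dominating H m a k n c = ∀ k′ n′ c′ l i d →
    Edge H 1 m a k′ n′ c′ → Edge H k′ n′ c′ l i d → ¬ ¬ Edge H k′ n′ c′ k n c

  dominating-unbounded : ∀ {H m a k n c} → Heights H → Edge H 1 m a k n c →
    Dominating H m a k n c → ∃[ v ] ∀ t → H m v t
  dominating-unbounded {c = c} h (along p) dom =
    -- A rational `y` is itself non-maximal and above `u`, so it would have to lie below itself.
    ⊥-elim (dom _ _ _ _ _ _ (along p) (along (<ℚ-natural c 0)) Edge-irrefl)
  dominating-unbounded {m = m} {a} {c = v} h (reach p _) dom
    with has-colour (Heights.base h m v) (Heights.down-closed h m v)
  ... | zero  , all  = v , all
  ... | suc i , spec = ⊥-elim (dom 1 m beyond _ _ _ (along (<ℚ-natural a i)) (along (<ℚ-natural beyond 0)) λ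
    { (reach {t = t} q h) →
        <-irrefl refl (≤-trans (≤-trans (natural-<ℚ q) (to (spec t) h)) (m≤n+m i (suc (fst a)))) })
    where
    beyond : ℕ
    -- The integer fst a + i + 2: above `a`, and past i + 1, below which a top of height i is
    -- confined.
    beyond = pair (suc (fst a) + i) 0

  module _ {X R H} (ce : CEIn X R) (iso : R ≅ Fence H) (heights : Heights H) where
    open _≅_ iso

    At : (ℕ → ℕ → ℕ → Set) → ℕ → Set
    At P x = P (kind (f x)) (branch (f x)) (position (f x))

    edge : ∀ {x y} → R x y → At (λ k m a → At (λ l n b → Edge H k m a l n b) y) x
    edge r = mono r

    below : ∀ {l i d y} → At (Edge H l i d) y → R (g (element l i d)) y
    below {l} {i} {d} {y} e = cancel (subst (λ x → Fence H x (f y)) (sym (fg (element l i d))) (packˡ {y = f y} e))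

    above : ∀ {l i d x} → At (λ k m a → Edge H k m a l i d) x → R x (g (element l i d))
    above {l} {i} {d} {x} e = cancel (subst (λ y → Fence H (f x) y) (sym (fg (element l i d))) (packʳ {x = f x} e))

    OnBranch : ℕ → ℕ → Set
    OnBranch m u = kind (f u) ≡ 1 × branch (f u) ≡ m

    at-branch : ∀ {m u} (P : ℕ → ℕ → ℕ → Set) → OnBranch m u → At P u ≡ P 1 m (position (f u))
    at-branch {u = u} P (k≡ , m≡) = cong₂ (λ k m → P k m (position (f u))) k≡ m≡

    module _ {m u l i d : ℕ} (u∈ : OnBranch m u) where

      target : At (Edge H l i d) u → Edge H l i d 1 m (position (f u))
      target = subst id (at-branch (Edge H l i d) u∈)

      untarget : Edge H l i d 1 m (position (f u)) → At (Edge H l i d) u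
      untarget = subst id (sym (at-branch (Edge H l i d) u∈))

      source : At (λ k n a → Edge H k n a l i d) u → Edge H 1 m (position (f u)) l i d
      source = subst id (at-branch (λ k n a → Edge H k n a l i d) u∈)

      unsource : Edge H 1 m (position (f u)) l i d → At (λ k n a → Edge H k n a l i d) u
      unsource = subst id (sym (at-branch (λ k n a → Edge H k n a l i d) u∈))

    point : ℕ → ℕ
    point m = g (element 1 m 0)

    point-on-branch : ∀ m → OnBranch m (point m)
    point-on-branch m =
      trans (cong kind (fg _)) (kind-element 1 m 0) , trans (cong branch (fg _)) (branch-element 1 m 0)

    next-sound : ∀ {m u v w} → OnBranch m u → OnBranch (suc m) v → Third ce u v w → OnBranch (2 + m) w
    next-sound {m} {u} {v} {w} u∈ v∈ ((q , qv , qw) , ¬uw , ¬wv , (q′ , wq′)) = third-branch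
      (_ , _ , _ , target v∈ (edge qv) , edge qw)
      (λ l i d eu ew → ¬uw (g (element l i d) , below (untarget u∈ eu) , below ew))
      (λ e → ¬wv (cancel (untarget v∈ e)))
      (_ , _ , _ , edge wq′)

    next-exists : ∀ {m u v} → OnBranch m u → OnBranch (suc m) v → ∃ (Third ce u v)
    next-exists {m} {u} {v} u∈ v∈ = w ,
      (g (element 2 (suc m) 0) , below (untarget v∈ (left ≤-refl)) ,
        below (untarget w∈ (right ≤-refl))) ,
      (λ (q , qu , qw) → no-common-lower-bound (target u∈ (edge qu)) (target w∈ (edge qw))) ,
      (λ wv → branch-ascent (target v∈ (source w∈ (edge wv)))) ,
      g (element 1 (2 + m) _) ,
        above (unsource w∈ (along (<ℚ-natural (position (f w)) 0)))
      where
      w = point (2 + m)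
      w∈ = point-on-branch (2 + m)

    dominates⇔ : ∀ {m u} → OnBranch m u → ∃ (Dominates ce u) ⇔ (∃[ v ] ∀ t → H m v t)
    dominates⇔ {m} {u} u∈ = mk⇔
      (λ (y , uy , dom) → dominating-unbounded heights (source u∈ (edge uy))
        λ k n c l i d e e′ ¬e → dom (pair (g (element k n c)) (g (element l i d)) ,
          subst (R u) (sym (fst-pair _ _)) (above (unsource u∈ e)) ,
          subst₂ R (sym (fst-pair _ _)) (sym (snd-pair _ _))
            (cancel (subst₂ (Fence H) (sym (fg _)) (sym (fg _)) (subst id (sym (Fence-element _ _ _ _ _ _)) e′))) ,
          λ r → ¬e (inner (subst (λ x → R x y) (fst-pair _ _) r))))
      (λ (v , all) → g (element 0 m v) ,
        above (unsource u∈ (reach (<ℚ-natural (position (f u)) 0) (all _))) ,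
        λ (q , uq , qq′ , ¬qy) → ¬qy (above (maximal-above-chain all (source u∈ (edge uq)) (edge qq′))))
      where
      inner : ∀ {k n c y} → R (g (element k n c)) y → At (Edge H k n c) y
      inner {k} {n} {c} {y} r = subst id (cong₂
        (λ km a → Edge H (proj₁ km) (proj₂ km) a (kind (f y)) (branch (f y)) (position (f y)))
        (cong₂ _,_ (trans (cong kind (fg _)) (kind-element k n c))
                   (trans (cong branch (fg _)) (branch-element k n c)))
        (trans (cong position (fg _)) (position-element k n c))) (edge r)

    -- Only two points are taken from the isomorphism. As constants they are computable, although
    -- the isomorphism need not be.
    walk : (ℕ → ℕ) → ℕ → ℕ
    walk M m = rec (pair (point 0) (point 1)) (λ _ s → pair (snd s) (M s)) m

    walk-computable : ∀ {O M} → Computable O M → Computable O (walk M)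
    walk-computable {M = M} M-computable = iterate-computable {H = λ _ s → pair (snd s) (M s)}
      (const-computable (pair (point 0) (point 1)))
      (curried (pair-computable (snd-computable ⊙ snd-computable) (M-computable ⊙ snd-computable))) id-computable

    walk-on-branches : ∀ {M} → (∀ s → ∃ (Next ce s) → Next ce s (M s)) →
      ∀ m → OnBranch m (fst (walk M m)) × OnBranch (suc m) (snd (walk M m))
    walk-on-branches M-next zero =
      subst (OnBranch 0) (sym (fst-pair _ _)) (point-on-branch 0) ,
      subst (OnBranch 1) (sym (snd-pair _ _)) (point-on-branch 1)
    walk-on-branches {M} M-next (suc m) with u∈ , v∈ ← walk-on-branches {M} M-next m =
      subst (OnBranch (suc m)) (sym (fst-pair _ _)) v∈ ,
      subst (OnBranch (2 + m)) (sym (snd-pair _ _)) (next-sound u∈ v∈ (M-next (walk M m) (next-exists u∈ v∈)))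

    opaque
      locate : ∃[ G ] Computable (jump (jump X)) G × (∀ m → OnBranch m (G m))
      locate with M , M-computable , M-next ← next-function ce =
        (λ m → fst (walk M m)) , fst-computable ⊙ walk-computable M-computable ,
        λ m → proj₁ (walk-on-branches {M} M-next m)

  module _ {A X R} (ce : CEIn X R) (iso : R ≅ Fence (Canonical A)) where

    criterion : ∀ {m u} → OnBranch ce iso (canonical-heights A) m u → ∃ (Dominates ce u) ⇔ Coded A m
    criterion {m} u∈ = mk⇔
      (to (canonical-unbounded A m) ∘ to dominates)
      (from dominates ∘ from (canonical-unbounded A m))
      where dominates = dominates⇔ ce iso (canonical-heights A) u∈

    module _ {G : ℕ → ℕ} (on-branch : ∀ m → OnBranch ce iso (canonical-heights A) m (G m)) where

      -- `w` packs a guessed value of the characteristic function at `n` and a top confirming it.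
      -- Wrong guesses have no such top, so any success is the answer.
      Certifies : ℕ → ℕ → Set
      Certifies n w = Dominates ce (G (pair n (fst w))) (snd w)

      certifiesʳ : Computable (jump (jump X)) G → Recursive (jump (jump X)) (λ z → Certifies (fst z) (snd z))
      certifiesʳ G-computable = dominatesʳ ce
        (G-computable ⊙ pair-computable fst-computable (fst-computable ⊙ snd-computable))
        (snd-computable ⊙ snd-computable)

      certificate-of : ∀ n b → Coded A (pair n b) → ∃ (Certifies n)
      certificate-of n b coded = let y , dom = from (criterion (on-branch (pair n b))) coded in pair b y ,
        subst₂ (λ b y → Dominates ce (G (pair n b)) y) (sym (fst-pair b y)) (sym (snd-pair b y)) dom

      -- Termination of the search: one of the two guesses is right. Excluded middle shows this
      -- without revealing which.
      certificate : ∀ n → ∃ (Certifies n)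
      certificate n with em {A n}
      ... | yes a = certificate-of n 1 (inj₁ (subst A (sym (fst-pair n 1)) a , snd-pair n 1))
      ... | no na = certificate-of n 0 (inj₂ (na ∘ subst A (fst-pair n 0) , snd-pair n 0))

      certified : ∀ n w → Certifies n w → Coded A (pair n (fst w))
      certified n w cert = to (criterion (on-branch (pair n (fst w)))) (snd w , cert)

      coded-from : (∃[ F ] Computable (jump (jump X)) F × (∀ n → Certifies n (F n))) →
        ∃[ D ] Computable (jump (jump X)) D × (∀ n → Coded A (pair n (D n)))
      coded-from (F , F-computable , spec) =
        (λ n → fst (F n)) , fst-computable ⊙ F-computable , λ n → certified n (F n) (spec n)

    coded-search : (∃[ G ] Computable (jump (jump X)) G × (∀ m → OnBranch ce iso (canonical-heights A) m (G m))) →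
      ∃[ D ] Computable (jump (jump X)) D × (∀ n → Coded A (pair n (D n)))
    coded-search (G , G-computable , on-branch) = coded-from on-branch
      (choiceʳ {P = Certifies on-branch} (certifiesʳ on-branch G-computable) (certificate on-branch))

  in-coded : ∀ {A n b} → A n → Coded A (pair n b) → b ≡ 1
  in-coded     a (inj₁ (_ , eq)) = trans (sym (snd-pair _ _)) eq
  in-coded {A} a (inj₂ (na , _)) = ⊥-elim (na (subst A (sym (fst-pair _ _)) a))

  out-coded : ∀ {A n b} → ¬ A n → Coded A (pair n b) → b ≡ 0
  out-coded {A} na (inj₁ (a , _))  = ⊥-elim (na (subst A (fst-pair _ _) a))
  out-coded     na (inj₂ (_ , eq)) = trans (sym (snd-pair _ _)) eq

  coded-reduces : ∀ {A O} → (∃[ D ] Computable O D × (∀ n → Coded A (pair n (D n)))) → A ≤T O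
  coded-reduces {A} {O} (D , computes e evaluates , coded) =
    e , λ n → (λ a → subst (Eval O e n) (in-coded {A} a (coded n)) (evaluates n)) ,
              (λ na → subst (Eval O e n) (out-coded {A} na (coded n)) (evaluates n))

  reduces : ∀ {A X R} → CEIn X R → R ≅ Fence (Canonical A) → A ≤T jump (jump X)
  reduces {A} ce iso = coded-reduces {A}
    (coded-search {A} ce iso (locate {H = Canonical A} ce iso (canonical-heights A)))

theorem33 : ExcludedMiddle 0ℓ →
    (A : Pred ℕ 0ℓ) →
    ∃[ ≺ ] Irreflexive {A = ℕ} _≡_ ≺ × Interpolable ≺ ×
    ((X : Pred ℕ 0ℓ) →
    (A ≤T jump (jump X)) ⇔ (∃[ R ] CEIn X R × Isomorphic R ≺))
theorem33 em A = Fence (Canonical A) , Fence-irreflexive ,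
  Fence-interpolable (Isomorphism.Heights.base (Construction.canonical-heights em A)) ,
  λ X → mk⇔ (Construction.ce-copy em A X) (λ (R , ce , iso) → Recognition.reduces em {A} ce (isomorphic⇒≅ iso))
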